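{- Let $P=\langle S,A,R\rangle$ be a functional Pure Type System such that $\lambda\Pi_P$ is terminating (every well-typed term of $\lambda\Pi_P$ is strongly normalizing for $\longrightarrow$). Let $A$ be a term of $P$ for which $\|A\|$ is defined. Then the type $\|A\|$ is inhabited by a closed term in $\lambda\Pi_P$ (i.e. there is $t$ with $\Sigma_P\vdash t:\|A\|$) if and only if the type $A$ is inhabited by a closed term in $P$ (i.e. there is $u$ with $[\,]\vdash u:A$ in $P$).
   Context: A Pure Type System $P=\langle S,A,R\rangle$ consists of a set $S$ of sorts, axioms $A\subseteq S\times S$ and rules $R\subseteq S\times S\times S$; its terms are $t::=x\mid s\mid \Pi x:t~t\mid \lambda x:t~t\mid t~t$ ($s\in S$), with the usual PTS typing rules (empty context, declaration $\Gamma[x:A]$ when $\Gamma\vdash A:s$, sort $\Gamma\vdash s_1:s_2$ for $\langle s_1,s_2\rangle\in A$, variable, product $\Gamma\vdash \Pi x:A~B:s_3$ from $\Gamma\vdash A:s_1$, $\Gamma[x:A]\vdash B:s_2$ with $\langle s_1,s_2,s_3\rangle\in R$, abstraction, application $\Gamma\vdash (t~u):(u/x)B$, and conversion modulo $\beta$-equivalence between types of the same sort). $P$ is functional if $\langle s_1,s_2\rangle,\langle s_1,s_3\rangle\in A$ implies $s_2=s_3$ and $\langle s_1,s_2,s_3\rangle,\langle s_1,s_2,s_4\rangle\in R$ implies $s_3=s_4$. The $\lambda\Pi$-calculus modulo: terms $t::=x\mid Type\mid Kind\mid \Pi x:t~t\mid\lambda x:t~t\mid t~t$, with the typing rules of the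 $\lambda\Pi$-calculus (axiom $Type:Kind$, products $\langle Type,Type,Type\rangle$ and $\langle Type,Kind,Kind\rangle$, corresponding abstractions, application, and declarations of variables whose type has type $Type$ or $Kind$), where the conversion rules use the congruence generated by $\beta$ and a given set of rewrite rules. Embedding of $P$: the context $\Sigma_P$ declares, for each sort $s$, $U_s:Type$ and $\varepsilon_s:U_s\Rightarrow Type$; for each axiom $\langle s_1,s_2\rangle$, $\dot{s_1}:U_{s_2}$; for each rule $\langle s_1,s_2,s_3\rangle$, $\dot\Pi_{\langle s_1,s_2,s_3\rangle}:\Pi X:U_{s_1}~(((\varepsilon_{s_1}~X)\Rightarrow U_{s_2})\Rightarrow U_{s_3})$. The rewrite rules are $\varepsilon_{s_2}~\dot{s_1}\longrightarrow U_{s_1}$ for each axiom and $\varepsilon_{s_3}(\dot\Pi_{\langle s_1,s_2,s_3\rangle}~X~Y)\longrightarrow \Pi x:(\varepsilon_{s_1}~X)~(\varepsilon_{s_2}~(Y~x))$ for each rule. $\lambda\Pi_P$ is the $\lambda\Pi$-calculus modulo these rules and $\beta$; $\equiv$ denotes the generated congruence, $\longrightarrow$ one-step $\beta$-or-rewrite reduction, and a judgement $\Gamma\vdash t:T$ in $\lambda\Pi_P$ means $\Sigma_P\Gamma\vdash t:T$. Translation of a term $t$ well-typed in a context $\Gamma$ of $P$: $|x|=x$; $|s|=\dot s$; $|\Pi x:A~B|=\dot\Pi_{\langle s_1,s_2,s_3\rangle}~|A|~(\lambda x:(\varepsilon_{s_1}~|A|)~|B|)$ where $s_1,s_2,s_3$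 are the types of $A$, $B$, $\Pi x:A~B$; $|\lambda x:A~t|=\lambda x:(\varepsilon_s~|A|)~|t|$ where $s$ is the type of $A$; $|t~u|=|t|~|u|$. For $A$ of type a sort $s$, $\|A\|=\varepsilon_s~|A|$; for a sort $s'$ that is not typable, $\|s'\|=U_{s'}$. Contexts: $\|[\,]\|=[\,]$, $\|\Gamma[x:A]\|=\|\Gamma\|[x:\|A\|]$. -}

module Defs where

open import Data.Nat using (ℕ; zero; suc)
open import Data.List using (List; []; _∷_)
open import Data.Product using (Σ; ∃; _×_; _,_)
open import Relation.Nullary using (¬_)
open import Relation.Binary.PropositionalEquality using (_≡_)
open import Relation.Binary.Construct.Closure.Equivalence using (EqClosure)
open import Induction.WellFounded using (Acc)

-- Generic raw terms with de Bruijn indices over a set C of constants.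
--   var n   : variable (de Bruijn index n)
--   con c   : constant (a sort of P, or a constant of λΠ_P)
--   pi A B  : Π x:A B     (B lives under one more binder)
--   lam A t : λ x:A t
--   app t u : t u

data Term (C : Set) : Set where
  var : ℕ → Term C
  con : C → Term C
  pi  : Term C → Term C → Term C
  lam : Term C → Term C → Term C
  app : Term C → Term C → Term C

module _ {C : Set} where

  ext : (ℕ → ℕ) → ℕ → ℕ
  ext ρ zero    = zero
  ext ρ (suc n) = suc (ρ n)

  rename : (ℕ → ℕ) → Term C → Term C
  rename ρ (var n)   = var (ρ n)
  rename ρ (con c)   = con c
  rename ρ (pi A B)  = pi (rename ρ A) (rename (ext ρ) B)
  rename ρ (lam A t) = lam (rename ρ A) (rename (ext ρ) t)
  rename ρ (app t u) = app (rename ρ t) (rename ρ u)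

  exts : (ℕ → Term C) → ℕ → Term C
  exts σ zero    = var zero
  exts σ (suc n) = rename suc (σ n)

  subst : (ℕ → Term C) → Term C → Term C
  subst σ (var n)   = σ n
  subst σ (con c)   = con c
  subst σ (pi A B)  = pi (subst σ A) (subst (exts σ) B)
  subst σ (lam A t) = lam (subst σ A) (subst (exts σ) t)
  subst σ (app t u) = app (subst σ t) (subst σ u)

  sub0 : Term C → ℕ → Term C
  sub0 u zero    = u
  sub0 u (suc n) = var n

  _[_] : Term C → Term C → Term C
  t [ u ] = subst (sub0 u) t

  data Beta : Term C → Term C → Set where
    β : ∀ A t u → Beta (app (lam A t) u) (t [ u ])

  data Step (R : Term C → Term C → Set) : Term C → Term C → Set where
    top  : ∀ {t u} → R t u → Step R t u
    piL  : ∀ {A A' B} → Step R A A' → Step R (pi A B) (pi A' B)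
    piR  : ∀ {A B B'} → Step R B B' → Step R (pi A B) (pi A B')
    lamL : ∀ {A A' t} → Step R A A' → Step R (lam A t) (lam A' t)
    lamR : ∀ {A t t'} → Step R t t' → Step R (lam A t) (lam A t')
    appL : ∀ {t t' u} → Step R t t' → Step R (app t u) (app t' u)
    appR : ∀ {t u u'} → Step R u u' → Step R (app t u) (app t u')

  -- contexts: list of types, head = most recent declaration (index 0)
  Ctx : Set
  Ctx = List (Term C)

  data _∋_⦂_ : Ctx → ℕ → Term C → Set where
    here  : ∀ {Γ A} → (A ∷ Γ) ∋ zero ⦂ rename suc A
    there : ∀ {Γ A B n} → Γ ∋ n ⦂ A → (B ∷ Γ) ∋ suc n ⦂ rename suc A

  _⇒_ : Term C → Term C → Term C
  A ⇒ B = pi A (rename suc B)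

record PTS : Set₁ where
  field
    Sort : Set
    Ax   : Sort → Sort → Set
    Rl   : Sort → Sort → Sort → Set

Functional : PTS → Set
Functional P = (∀ {s1 s2 s3} → Ax s1 s2 → Ax s1 s3 → s2 ≡ s3)
             × (∀ {s1 s2 s3 s4} → Rl s1 s2 s3 → Rl s1 s2 s4 → s3 ≡ s4)
  where open PTS P

data LConst (S : Set) : Set where
  Type  : LConst S
  Kind  : LConst S
  U     : S → LConst S
  eps   : S → LConst S
  dot   : S → S → LConst S              -- ṡ1 declared for the axiom ⟨s1,s2⟩
  dotPi : S → S → S → LConst S

module Typing (P : PTS) where
  open PTS P

  PTerm : Set
  PTerm = Term Sort

  PCtx : Set
  PCtx = Ctx {Sort}

  _≡β_ : PTerm → PTerm → Set
  _≡β_ = EqClosure (Step Beta)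

  mutual
    data WF : PCtx → Set where
      wf-nil  : WF []
      wf-cons : ∀ {Γ A s} → Γ ⊢ A ∶ con s → WF (A ∷ Γ)

    data _⊢_∶_ : PCtx → PTerm → PTerm → Set where
      ⊢sort : ∀ {Γ s1 s2} → WF Γ → Ax s1 s2 → Γ ⊢ con s1 ∶ con s2
      ⊢var  : ∀ {Γ n A} → WF Γ → Γ ∋ n ⦂ A → Γ ⊢ var n ∶ A
      ⊢pi   : ∀ {Γ A B s1 s2 s3} → Γ ⊢ A ∶ con s1 → (A ∷ Γ) ⊢ B ∶ con s2 →
              Rl s1 s2 s3 → Γ ⊢ pi A B ∶ con s3
      ⊢lam  : ∀ {Γ A B t s1 s2 s3} → Γ ⊢ A ∶ con s1 → (A ∷ Γ) ⊢ B ∶ con s2 →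
              Rl s1 s2 s3 → (A ∷ Γ) ⊢ t ∶ B → Γ ⊢ lam A t ∶ pi A B
      ⊢app  : ∀ {Γ t u A B} → Γ ⊢ t ∶ pi A B → Γ ⊢ u ∶ A → Γ ⊢ app t u ∶ (B [ u ])
      ⊢conv : ∀ {Γ t A B s} → Γ ⊢ t ∶ A → Γ ⊢ A ∶ con s → Γ ⊢ B ∶ con s →
              A ≡β B → Γ ⊢ t ∶ B

  LTerm : Set
  LTerm = Term (LConst Sort)

  LCtx : Set
  LCtx = Ctx {LConst Sort}

  ⟪_⟫ : LConst Sort → LTerm
  ⟪ c ⟫ = con c

  data Rw : LTerm → LTerm → Set where
    rw-β  : ∀ {t u} → Beta t u → Rw t u
    rw-ax : ∀ {s1 s2} → Ax s1 s2 →
            Rw (app ⟪ eps s2 ⟫ ⟪ dot s1 s2 ⟫) ⟪ U s1 ⟫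
    rw-pi : ∀ {s1 s2 s3} X Y → Rl s1 s2 s3 →
            Rw (app ⟪ eps s3 ⟫ (app (app ⟪ dotPi s1 s2 s3 ⟫ X) Y))
               (pi (app ⟪ eps s1 ⟫ X) (app ⟪ eps s2 ⟫ (app (rename suc Y) (var zero))))

  _⟶_ : LTerm → LTerm → Set
  _⟶_ = Step Rw

  _≡R_ : LTerm → LTerm → Set
  _≡R_ = EqClosure _⟶_

  -- the sorts of λΠ and its product rules ⟨Type,Type,Type⟩, ⟨Type,Kind,Kind⟩
  data LSort : LTerm → Set where
    isType : LSort ⟪ Type ⟫
    isKind : LSort ⟪ Kind ⟫

  data SigType : LConst Sort → LTerm → Set where
    sig-U     : ∀ s → SigType (U s) ⟪ Type ⟫
    sig-eps   : ∀ s → SigType (eps s) (⟪ U s ⟫ ⇒ ⟪ Type ⟫)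
    sig-dot   : ∀ {s1 s2} → Ax s1 s2 → SigType (dot s1 s2) ⟪ U s2 ⟫
    sig-dotPi : ∀ {s1 s2 s3} → Rl s1 s2 s3 →
                SigType (dotPi s1 s2 s3)
                  (pi ⟪ U s1 ⟫ (((app ⟪ eps s1 ⟫ (var zero)) ⇒ ⟪ U s2 ⟫) ⇒ ⟪ U s3 ⟫))

  -- Γ ⊢λ t ∶ T  means  Σ_P Γ ⊢ t : T  in λΠ_P
  mutual
    data LWF : LCtx → Set where
      lwf-nil  : LWF []
      lwf-cons : ∀ {Γ A s} → LSort s → Γ ⊢λ A ∶ s → LWF (A ∷ Γ)

    data _⊢λ_∶_ : LCtx → LTerm → LTerm → Set where
      ⊢Type  : ∀ {Γ} → LWF Γ → Γ ⊢λ ⟪ Type ⟫ ∶ ⟪ Kind ⟫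
      ⊢const : ∀ {Γ c T} → LWF Γ → SigType c T → Γ ⊢λ con c ∶ T
      ⊢var   : ∀ {Γ n A} → LWF Γ → Γ ∋ n ⦂ A → Γ ⊢λ var n ∶ A
      ⊢pi    : ∀ {Γ A B s} → LSort s → Γ ⊢λ A ∶ ⟪ Type ⟫ → (A ∷ Γ) ⊢λ B ∶ s →
               Γ ⊢λ pi A B ∶ s
      ⊢lam   : ∀ {Γ A B t s} → LSort s → Γ ⊢λ A ∶ ⟪ Type ⟫ → (A ∷ Γ) ⊢λ B ∶ s →
               (A ∷ Γ) ⊢λ t ∶ B → Γ ⊢λ lam A t ∶ pi A B
      ⊢app   : ∀ {Γ t u A B} → Γ ⊢λ t ∶ pi A B → Γ ⊢λ u ∶ A →
               Γ ⊢λ app t u ∶ (B [ u ])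
      ⊢conv  : ∀ {Γ t A B s} → LSort s → Γ ⊢λ t ∶ A → Γ ⊢λ A ∶ s → Γ ⊢λ B ∶ s →
               A ≡R B → Γ ⊢λ t ∶ B

  _⟵_ : LTerm → LTerm → Set
  u ⟵ t = t ⟶ u

  SN : LTerm → Set
  SN = Acc _⟵_

  Terminating : Set
  Terminating = ∀ Γ t T → Γ ⊢λ t ∶ T → SN t

  -- The translation |t| (as a relation: Tr Γ t t' means |t| = t' for t
  -- typed in Γ; the sorts used are the types of the relevant subterms)

  data Tr : PCtx → PTerm → LTerm → Set where
    tr-var  : ∀ {Γ n} → Tr Γ (var n) (var n)
    tr-sort : ∀ {Γ s1 s2} → Ax s1 s2 → Tr Γ (con s1) ⟪ dot s1 s2 ⟫
    tr-pi   : ∀ {Γ A B a b s1 s2 s3} →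
              Γ ⊢ A ∶ con s1 → (A ∷ Γ) ⊢ B ∶ con s2 → Γ ⊢ pi A B ∶ con s3 →
              Tr Γ A a → Tr (A ∷ Γ) B b →
              Tr Γ (pi A B)
                 (app (app ⟪ dotPi s1 s2 s3 ⟫ a) (lam (app ⟪ eps s1 ⟫ a) b))
    tr-lam  : ∀ {Γ A t a b s} → Γ ⊢ A ∶ con s → Tr Γ A a → Tr (A ∷ Γ) t b →
              Tr Γ (lam A t) (lam (app ⟪ eps s ⟫ a) b)
    tr-app  : ∀ {Γ t u a b} → Tr Γ t a → Tr Γ u b → Tr Γ (app t u) (app a b)

  -- ‖A‖ (as a relation: TrTy Γ A T means ‖A‖ = T in context Γ)
  data TrTy : PCtx → PTerm → LTerm → Set where
    trty-typed : ∀ {Γ A a s} → Γ ⊢ A ∶ con s → Tr Γ A a →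
                 TrTy Γ A (app ⟪ eps s ⟫ a)
    trty-sort  : ∀ {Γ s'} → (∀ T → ¬ (Γ ⊢ con s' ∶ T)) →
                 TrTy Γ (con s') ⟪ U s' ⟫

{-# OPTIONS --safe #-}

-- From P to λΠ_P, all choices of sort decorations in the translation of one term
-- become convertible once the results are well typed in λΠ_P, because types are
-- unique there and P is functional.  Hence Γ ⊢ t : A can be translated by
-- induction, using only confluence of β on the side of P.
--
-- From λΠ_P to P, first η-expand every Π̇ in the inhabitant t of ‖A‖ (this does not
-- change ‖A‖ up to conversion), then β-normalise it.  By induction on the resulting
-- weak η-long normal form, it is convertible to |u| for some u of type A: its head
-- is a variable, some ṡ or a fully applied Π̇, and whenever ‖B‖ ≡ Π x:C D, erasing
-- ε, U and the decorations shows that B reduces to a product.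
module Submission where

open import Defs
open import Data.Nat using (ℕ; zero; suc)
open import Data.Empty using (⊥; ⊥-elim)
open import Data.Unit using (⊤; tt)
open import Data.Product using (∃; _×_; _,_; proj₁; proj₂)
open import Data.Sum using (_⊎_; inj₁; inj₂)
open import Data.List using ([]; _∷_; map)
open import Relation.Nullary using (¬_)
open import Relation.Binary.PropositionalEquality using (_≡_; refl; sym; trans; cong; cong₂) renaming (subst to transport)
open import Relation.Binary.Construct.Closure.ReflexiveTransitive using (Star; ε; _◅_; _◅◅_; gmap)
open import Relation.Binary.Construct.Closure.Symmetric using (fwd; bwd)
open import Relation.Binary.Construct.Closure.Equivalence as Equivalence using (EqClosure; symmetric)
open import Induction.WellFounded using (Acc; acc)

-- The reconstructed term is only convertible to the given inhabitant, because λ-annotations in a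
-- normal inhabitant are arbitrary types of λΠ_P that need not be translations. They are therefore
-- replaced by annotations read off the expected type, and convertibility is enough because types
-- matter only up to the congruence. Termination serves only to β-normalise the η-expanded
-- inhabitant; normal forms of types are never taken, neither in P nor in λΠ_P. The delicate step is
-- finding a domain and a codomain when ‖A‖ is convertible to a product whose components are not
-- translations. Erasure lands in raw, possibly ill-typed terms of P, but β is confluent on raw
-- terms, so `A` itself reduces to a product. Subject reduction in P types that product, and
-- replaying the reduction on |A| provides the codes of its components. Expanding Π̇ is compatible
-- with a congruence without η because its rewrite rule uses the second argument only applied to a
-- variable.

module _ {C : Set} where

  -- Renaming and substitution calculus

  ext-∘ : ∀ {ρ₁ ρ₂ ρ₃ : ℕ → ℕ} → (∀ n → ρ₂ (ρ₁ n) ≡ ρ₃ n) →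
          ∀ n → ext {C} ρ₂ (ext {C} ρ₁ n) ≡ ext {C} ρ₃ n
  ext-∘ h zero    = refl
  ext-∘ h (suc n) = cong suc (h n)

  rename-rename : ∀ {ρ₁ ρ₂ ρ₃} → (∀ n → ρ₂ (ρ₁ n) ≡ ρ₃ n) →
                  ∀ (t : Term C) → rename ρ₂ (rename ρ₁ t) ≡ rename ρ₃ t
  rename-rename h (var n)   = cong var (h n)
  rename-rename h (con c)   = refl
  rename-rename h (pi A B)  = cong₂ pi (rename-rename h A) (rename-rename (ext-∘ h) B)
  rename-rename h (lam A t) = cong₂ lam (rename-rename h A) (rename-rename (ext-∘ h) t)
  rename-rename h (app t u) = cong₂ app (rename-rename h t) (rename-rename h u)

  rename-wk : ∀ ρ (t : Term C) → rename (ext {C} ρ) (rename suc t) ≡ rename suc (rename ρ t)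
  rename-wk ρ t = trans (rename-rename (λ _ → refl) t) (sym (rename-rename (λ _ → refl) t))

  exts-ext : ∀ {σ τ : ℕ → Term C} {ρ} → (∀ n → σ (ρ n) ≡ τ n) →
             ∀ n → exts σ (ext {C} ρ n) ≡ exts τ n
  exts-ext h zero    = refl
  exts-ext h (suc n) = cong (rename suc) (h n)

  subst-rename : ∀ {σ τ : ℕ → Term C} {ρ} → (∀ n → σ (ρ n) ≡ τ n) →
                 ∀ t → subst σ (rename ρ t) ≡ subst τ t
  subst-rename h (var n)   = h n
  subst-rename h (con c)   = refl
  subst-rename h (pi A B)  = cong₂ pi (subst-rename h A) (subst-rename (exts-ext h) B)
  subst-rename h (lam A t) = cong₂ lam (subst-rename h A) (subst-rename (exts-ext h) t)
  subst-rename h (app t u) = cong₂ app (subst-rename h t) (subst-rename h u)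

  ext-exts : ∀ {σ τ : ℕ → Term C} {ρ} → (∀ n → rename ρ (σ n) ≡ τ n) →
             ∀ n → rename (ext {C} ρ) (exts σ n) ≡ exts τ n
  ext-exts h zero = refl
  ext-exts {σ} {ρ = ρ} h (suc n) = trans (rename-wk ρ (σ n)) (cong (rename suc) (h n))

  rename-subst : ∀ {σ τ : ℕ → Term C} {ρ} → (∀ n → rename ρ (σ n) ≡ τ n) →
                 ∀ t → rename ρ (subst σ t) ≡ subst τ t
  rename-subst h (var n)   = h n
  rename-subst h (con c)   = refl
  rename-subst h (pi A B)  = cong₂ pi (rename-subst h A) (rename-subst (ext-exts h) B)
  rename-subst h (lam A t) = cong₂ lam (rename-subst h A) (rename-subst (ext-exts h) t)
  rename-subst h (app t u) = cong₂ app (rename-subst h t) (rename-subst h u)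

  subst-wk : ∀ σ (t : Term C) → subst (exts σ) (rename suc t) ≡ rename suc (subst σ t)
  subst-wk σ t = trans (subst-rename (λ _ → refl) t) (sym (rename-subst (λ _ → refl) t))

  exts-∘ : ∀ {σ τ υ : ℕ → Term C} → (∀ n → subst τ (σ n) ≡ υ n) →
           ∀ n → subst (exts τ) (exts σ n) ≡ exts υ n
  exts-∘ h zero = refl
  exts-∘ {σ} {τ} h (suc n) = trans (subst-wk τ (σ n)) (cong (rename suc) (h n))

  subst-subst : ∀ {σ τ υ : ℕ → Term C} → (∀ n → subst τ (σ n) ≡ υ n) →
                ∀ t → subst τ (subst σ t) ≡ subst υ t
  subst-subst h (var n)   = h n
  subst-subst h (con c)   = refl
  subst-subst h (pi A B)  = cong₂ pi (subst-subst h A) (subst-subst (exts-∘ h) B)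
  subst-subst h (lam A t) = cong₂ lam (subst-subst h A) (subst-subst (exts-∘ h) t)
  subst-subst h (app t u) = cong₂ app (subst-subst h t) (subst-subst h u)

  exts-var : ∀ {σ : ℕ → Term C} {ρ} → (∀ n → σ n ≡ var (ρ n)) →
             ∀ n → exts σ n ≡ var (ext {C} ρ n)
  exts-var h zero    = refl
  exts-var h (suc n) = cong (rename suc) (h n)

  subst-var : ∀ {σ : ℕ → Term C} {ρ} → (∀ n → σ n ≡ var (ρ n)) →
              ∀ t → subst σ t ≡ rename ρ t
  subst-var h (var n)   = h n
  subst-var h (con c)   = refl
  subst-var h (pi A B)  = cong₂ pi (subst-var h A) (subst-var (exts-var h) B)
  subst-var h (lam A t) = cong₂ lam (subst-var h A) (subst-var (exts-var h) t)
  subst-var h (app t u) = cong₂ app (subst-var h t) (subst-var h u)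

  ext-id : ∀ {ρ : ℕ → ℕ} → (∀ n → ρ n ≡ n) → ∀ n → ext {C} ρ n ≡ n
  ext-id h zero    = refl
  ext-id h (suc n) = cong suc (h n)

  rename-id : ∀ {ρ} → (∀ n → ρ n ≡ n) → ∀ (t : Term C) → rename ρ t ≡ t
  rename-id h (var n)   = cong var (h n)
  rename-id h (con c)   = refl
  rename-id h (pi A B)  = cong₂ pi (rename-id h A) (rename-id (ext-id h) B)
  rename-id h (lam A t) = cong₂ lam (rename-id h A) (rename-id (ext-id h) t)
  rename-id h (app t u) = cong₂ app (rename-id h t) (rename-id h u)

  subst-id : ∀ {σ : ℕ → Term C} → (∀ n → σ n ≡ var n) → ∀ t → subst σ t ≡ t
  subst-id h t = trans (subst-var h t) (rename-id (λ _ → refl) t)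

  wk-[] : ∀ (t u : Term C) → rename suc t [ u ] ≡ t
  wk-[] t u = trans (subst-rename (λ _ → refl) t) (subst-id (λ _ → refl) t)

  ext-suc-[var0] : ∀ (t : Term C) → rename (ext {C} suc) t [ var zero ] ≡ t
  ext-suc-[var0] t = trans (subst-rename {τ = var} h t) (subst-id (λ _ → refl) t)
    where
    h : ∀ n → sub0 (var zero) (ext {C} suc n) ≡ var n
    h zero    = refl
    h (suc n) = refl

  subst-[] : ∀ σ (t u : Term C) → subst σ (t [ u ]) ≡ subst (exts σ) t [ subst σ u ]
  subst-[] σ t u = trans (subst-subst (λ _ → refl) t) (sym (subst-subst h t))
    where
    h : ∀ n → subst (sub0 (subst σ u)) (exts σ n) ≡ subst σ (sub0 u n)
    h zero    = refl
    h (suc n) = wk-[] (σ n) (subst σ u)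

  rename-[] : ∀ ρ (t u : Term C) → rename ρ (t [ u ]) ≡ rename (ext {C} ρ) t [ rename ρ u ]
  rename-[] ρ t u = trans (rename-subst (λ _ → refl) t) (sym (subst-rename h t))
    where
    h : ∀ n → sub0 (rename ρ u) (ext {C} ρ n) ≡ rename ρ (sub0 u n)
    h zero    = refl
    h (suc n) = refl

  con-injective : ∀ {c d : C} → con c ≡ con d → c ≡ d
  con-injective refl = refl

  Step-map : ∀ {R R' : Term C → Term C → Set} → (∀ {t u} → R t u → R' t u) →
             ∀ {t u} → Step R t u → Step R' t u
  Step-map h (top r)  = top (h r)
  Step-map h (piL s)  = piL (Step-map h s)
  Step-map h (piR s)  = piR (Step-map h s)
  Step-map h (lamL s) = lamL (Step-map h s)
  Step-map h (lamR s) = lamR (Step-map h s)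
  Step-map h (appL s) = appL (Step-map h s)
  Step-map h (appR s) = appR (Step-map h s)

-- The rewrite rules of λΠ_P have the two shapes below; with both relations
-- empty, plain β-reduction is an instance.
record Rules (C : Set) : Set₁ where
  field
    AxR : C → C → C → Set
    PiR : C → C → C → C → Set
    AxR-functional : ∀ {e d u v} → AxR e d u → AxR e d v → u ≡ v
    PiR-functional : ∀ {e p a b a' b'} → PiR e p a b → PiR e p a' b' → a ≡ a' × b ≡ b'
    PiR-AxR-disjoint : ∀ {e p a b d u} → PiR e p a b → ¬ AxR p d u
    PiR-PiR-disjoint : ∀ {e p a b q a' b'} → PiR e p a b → ¬ PiR p q a' b'

-- Confluence of β with the rewrite rules

module Reduction {C : Set} (rules : Rules C) where
  open Rules rules

  data Root : Term C → Term C → Set where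
    root-β  : ∀ {t u} → Beta t u → Root t u
    root-ax : ∀ {e d u} → AxR e d u → Root (app (con e) (con d)) (con u)
    root-pi : ∀ {e p a b} X Y → PiR e p a b →
              Root (app (con e) (app (app (con p) X) Y))
                   (pi (app (con a) X) (app (con b) (app (rename suc Y) (var zero))))

  infix 4 _⟶₁_ _⟶*_ _≃_ _⇛_ _⇛*_

  _⟶₁_ _⟶*_ _≃_ : Term C → Term C → Set
  _⟶₁_ = Step Root
  _⟶*_ = Star _⟶₁_
  _≃_  = EqClosure _⟶₁_

  ≃-sym : ∀ {t u} → t ≃ u → u ≃ t
  ≃-sym = symmetric _

  ⟶⇒≃ : ∀ {t u} → t ⟶₁ u → t ≃ u
  ⟶⇒≃ s = fwd s ◅ ε

  ⟶*⇒≃ : ∀ {t u} → t ⟶* u → t ≃ u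
  ⟶*⇒≃ = gmap (λ t → t) fwd

  ≡⇒≃ : ∀ {t u} → t ≡ u → t ≃ u
  ≡⇒≃ refl = ε

  ≃-cong₁ : ∀ (f : Term C → Term C) → (∀ {t u} → t ⟶₁ u → f t ⟶₁ f u) → ∀ {t u} → t ≃ u → f t ≃ f u
  ≃-cong₁ f h = Equivalence.gmap f h

  ≃-pi : ∀ {A A' B B'} → A ≃ A' → B ≃ B' → pi A B ≃ pi A' B'
  ≃-pi p q = ≃-cong₁ (λ A → pi A _) piL p ◅◅ ≃-cong₁ (pi _) piR q

  ≃-lam : ∀ {A A' t t'} → A ≃ A' → t ≃ t' → lam A t ≃ lam A' t'
  ≃-lam p q = ≃-cong₁ (λ A → lam A _) lamL p ◅◅ ≃-cong₁ (lam _) lamR q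

  ≃-app : ∀ {t t' u u'} → t ≃ t' → u ≃ u' → app t u ≃ app t' u'
  ≃-app p q = ≃-cong₁ (λ t → app t _) appL p ◅◅ ≃-cong₁ (app _) appR q

  Root-subst : ∀ σ {t u} → Root t u → Root (subst σ t) (subst σ u)
  Root-subst σ (root-β (β A t u)) =
    transport (Root _) (sym (subst-[] σ t u)) (root-β (β _ _ _))
  Root-subst σ (root-ax r) = root-ax r
  Root-subst σ (root-pi {a = a} {b} X Y r) =
    transport (Root _) (cong (λ Z → pi (app (con a) (subst σ X)) (app (con b) (app Z (var zero)))) (sym (subst-wk σ Y)))
              (root-pi _ _ r)

  Step-subst : ∀ σ {t u} → t ⟶₁ u → subst σ t ⟶₁ subst σ u
  Step-subst σ (top r)  = top (Root-subst σ r)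
  Step-subst σ (piL s)  = piL (Step-subst σ s)
  Step-subst σ (piR s)  = piR (Step-subst (exts σ) s)
  Step-subst σ (lamL s) = lamL (Step-subst σ s)
  Step-subst σ (lamR s) = lamR (Step-subst (exts σ) s)
  Step-subst σ (appL s) = appL (Step-subst σ s)
  Step-subst σ (appR s) = appR (Step-subst σ s)

  ≃-subst : ∀ σ {t u} → t ≃ u → subst σ t ≃ subst σ u
  ≃-subst σ = ≃-cong₁ (subst σ) (Step-subst σ)

  ≃-rename : ∀ ρ {t u} → t ≃ u → rename ρ t ≃ rename ρ u
  ≃-rename ρ {t} {u} p =
    ≡⇒≃ (sym (subst-var (λ _ → refl) t)) ◅◅ ≃-subst (λ n → var (ρ n)) p ◅◅ ≡⇒≃ (subst-var (λ _ → refl) u)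

  ≃-substˡ : ∀ {σ τ} → (∀ n → σ n ≃ τ n) → ∀ t → subst σ t ≃ subst τ t
  ≃-exts : ∀ {σ τ} → (∀ n → σ n ≃ τ n) → ∀ n → exts σ n ≃ exts τ n

  ≃-substˡ h (var n)   = h n
  ≃-substˡ h (con c)   = ε
  ≃-substˡ h (pi A B)  = ≃-pi (≃-substˡ h A) (≃-substˡ (≃-exts h) B)
  ≃-substˡ h (lam A t) = ≃-lam (≃-substˡ h A) (≃-substˡ (≃-exts h) t)
  ≃-substˡ h (app t u) = ≃-app (≃-substˡ h t) (≃-substˡ h u)

  ≃-exts h zero    = ε
  ≃-exts h (suc n) = ≃-rename suc (h n)

  ≃-[] : ∀ {t t' u u'} → t ≃ t' → u ≃ u' → t [ u ] ≃ t' [ u' ]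
  ≃-[] {t' = t'} {u} {u'} p q = ≃-subst (sub0 u) p ◅◅ ≃-substˡ h t'
    where
    h : ∀ n → sub0 u n ≃ sub0 u' n
    h zero    = q
    h (suc n) = ε

  app-wk-lam-≃ : ∀ {A t} → app (rename suc (lam A t)) (var zero) ≃ t
  app-wk-lam-≃ {t = t} = ⟶⇒≃ (top (root-β (β _ _ _))) ◅◅ ≡⇒≃ (ext-suc-[var0] t)

  -- Parallel reduction in the style of Tait and Martin-Löf, with the rewrite rules treated like β:
  -- the arguments of a redex are reduced together with its contraction.
  data _⇛_ : Term C → Term C → Set where
    ⇛var : ∀ {n} → var n ⇛ var n
    ⇛con : ∀ {c} → con c ⇛ con c
    ⇛pi  : ∀ {A A' B B'} → A ⇛ A' → B ⇛ B' → pi A B ⇛ pi A' B'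
    ⇛lam : ∀ {A A' t t'} → A ⇛ A' → t ⇛ t' → lam A t ⇛ lam A' t'
    ⇛app : ∀ {t t' u u'} → t ⇛ t' → u ⇛ u' → app t u ⇛ app t' u'
    ⇛β   : ∀ {A t t' u u'} → t ⇛ t' → u ⇛ u' → app (lam A t) u ⇛ t' [ u' ]
    ⇛ax  : ∀ {e d u} → AxR e d u → app (con e) (con d) ⇛ con u
    ⇛Pi  : ∀ {e p a b X X' Y Y'} → PiR e p a b → X ⇛ X' → Y ⇛ Y' →
           app (con e) (app (app (con p) X) Y)
           ⇛ pi (app (con a) X') (app (con b) (app (rename suc Y') (var zero)))

  _⇛*_ : Term C → Term C → Set
  _⇛*_ = Star _⇛_

  ⇛-refl : ∀ t → t ⇛ t
  ⇛-refl (var n)   = ⇛var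
  ⇛-refl (con c)   = ⇛con
  ⇛-refl (pi A B)  = ⇛pi (⇛-refl A) (⇛-refl B)
  ⇛-refl (lam A t) = ⇛lam (⇛-refl A) (⇛-refl t)
  ⇛-refl (app t u) = ⇛app (⇛-refl t) (⇛-refl u)

  ⟶⇒⇛ : ∀ {t u} → t ⟶₁ u → t ⇛ u
  ⟶⇒⇛ (top (root-β (β A t u)))  = ⇛β (⇛-refl t) (⇛-refl u)
  ⟶⇒⇛ (top (root-ax r))         = ⇛ax r
  ⟶⇒⇛ (top (root-pi X Y r))     = ⇛Pi r (⇛-refl X) (⇛-refl Y)
  ⟶⇒⇛ (piL s)  = ⇛pi (⟶⇒⇛ s) (⇛-refl _)
  ⟶⇒⇛ (piR s)  = ⇛pi (⇛-refl _) (⟶⇒⇛ s)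
  ⟶⇒⇛ (lamL s) = ⇛lam (⟶⇒⇛ s) (⇛-refl _)
  ⟶⇒⇛ (lamR s) = ⇛lam (⇛-refl _) (⟶⇒⇛ s)
  ⟶⇒⇛ (appL s) = ⇛app (⟶⇒⇛ s) (⇛-refl _)
  ⟶⇒⇛ (appR s) = ⇛app (⇛-refl _) (⟶⇒⇛ s)

  ⟶*-pi : ∀ {A A' B B'} → A ⟶* A' → B ⟶* B' → pi A B ⟶* pi A' B'
  ⟶*-pi p q = gmap (λ A → pi A _) piL p ◅◅ gmap (pi _) piR q

  ⟶*-lam : ∀ {A A' t t'} → A ⟶* A' → t ⟶* t' → lam A t ⟶* lam A' t'
  ⟶*-lam p q = gmap (λ A → lam A _) lamL p ◅◅ gmap (lam _) lamR q

  ⟶*-app : ∀ {t t' u u'} → t ⟶* t' → u ⟶* u' → app t u ⟶* app t' u'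
  ⟶*-app p q = gmap (λ t → app t _) appL p ◅◅ gmap (app _) appR q

  ⇛⇒⟶* : ∀ {t u} → t ⇛ u → t ⟶* u
  ⇛⇒⟶* ⇛var       = ε
  ⇛⇒⟶* ⇛con       = ε
  ⇛⇒⟶* (⇛pi p q)  = ⟶*-pi (⇛⇒⟶* p) (⇛⇒⟶* q)
  ⇛⇒⟶* (⇛lam p q) = ⟶*-lam (⇛⇒⟶* p) (⇛⇒⟶* q)
  ⇛⇒⟶* (⇛app p q) = ⟶*-app (⇛⇒⟶* p) (⇛⇒⟶* q)
  ⇛⇒⟶* (⇛β p q)   =
    ⟶*-app (⟶*-lam ε (⇛⇒⟶* p)) (⇛⇒⟶* q) ◅◅ (top (root-β (β _ _ _)) ◅ ε)
  ⇛⇒⟶* (⇛ax r)    = top (root-ax r) ◅ ε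
  ⇛⇒⟶* (⇛Pi r p q) =
    ⟶*-app ε (⟶*-app (⟶*-app ε (⇛⇒⟶* p)) (⇛⇒⟶* q)) ◅◅ (top (root-pi _ _ r) ◅ ε)

  ⇛*⇒⟶* : ∀ {t u} → t ⇛* u → t ⟶* u
  ⇛*⇒⟶* ε        = ε
  ⇛*⇒⟶* (p ◅ ps) = ⇛⇒⟶* p ◅◅ ⇛*⇒⟶* ps

  ⇛-rename : ∀ ρ {t u} → t ⇛ u → rename ρ t ⇛ rename ρ u
  ⇛-rename ρ ⇛var       = ⇛var
  ⇛-rename ρ ⇛con       = ⇛con
  ⇛-rename ρ (⇛pi p q)  = ⇛pi (⇛-rename ρ p) (⇛-rename _ q)
  ⇛-rename ρ (⇛lam p q) = ⇛lam (⇛-rename ρ p) (⇛-rename _ q)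
  ⇛-rename ρ (⇛app p q) = ⇛app (⇛-rename ρ p) (⇛-rename ρ q)
  ⇛-rename ρ (⇛β {t' = t'} {u' = u'} p q) =
    transport (_⇛_ _) (sym (rename-[] ρ t' u')) (⇛β (⇛-rename _ p) (⇛-rename ρ q))
  ⇛-rename ρ (⇛ax r)    = ⇛ax r
  ⇛-rename ρ (⇛Pi {a = a} {b} {X' = X'} {Y' = Y'} r p q) =
    transport (_⇛_ _) (cong (λ Z → pi (app (con a) (rename ρ X')) (app (con b) (app Z (var zero)))) (sym (rename-wk ρ Y')))
              (⇛Pi r (⇛-rename ρ p) (⇛-rename ρ q))

  ⇛-exts : ∀ {σ τ} → (∀ n → σ n ⇛ τ n) → ∀ n → exts σ n ⇛ exts τ n
  ⇛-exts h zero    = ⇛var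
  ⇛-exts h (suc n) = ⇛-rename suc (h n)

  ⇛-subst : ∀ {σ τ} → (∀ n → σ n ⇛ τ n) → ∀ {t u} → t ⇛ u → subst σ t ⇛ subst τ u
  ⇛-subst h ⇛var       = h _
  ⇛-subst h ⇛con       = ⇛con
  ⇛-subst h (⇛pi p q)  = ⇛pi (⇛-subst h p) (⇛-subst (⇛-exts h) q)
  ⇛-subst h (⇛lam p q) = ⇛lam (⇛-subst h p) (⇛-subst (⇛-exts h) q)
  ⇛-subst h (⇛app p q) = ⇛app (⇛-subst h p) (⇛-subst h q)
  ⇛-subst {τ = τ} h (⇛β {t' = t'} {u' = u'} p q) =
    transport (_⇛_ _) (sym (subst-[] τ t' u')) (⇛β (⇛-subst (⇛-exts h) p) (⇛-subst h q))
  ⇛-subst h (⇛ax r)    = ⇛ax r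
  ⇛-subst {τ = τ} h (⇛Pi {a = a} {b} {X' = X'} {Y' = Y'} r p q) =
    transport (_⇛_ _) (cong (λ Z → pi (app (con a) (subst τ X')) (app (con b) (app Z (var zero)))) (sym (subst-wk τ Y')))
              (⇛Pi r (⇛-subst h p) (⇛-subst h q))

  ⇛-[] : ∀ {t t' u u'} → t ⇛ t' → u ⇛ u' → t [ u ] ⇛ t' [ u' ]
  ⇛-[] {u = u} {u'} p q = ⇛-subst h p
    where
    h : ∀ n → sub0 u n ⇛ sub0 u' n
    h zero    = q
    h (suc n) = ⇛var

  ⇛Pi-target : ∀ {a b X X' Y Y'} → X ⇛ X' → Y ⇛ Y' →
               pi (app (con a) X) (app (con b) (app (rename suc Y) (var zero)))
               ⇛ pi (app (con a) X') (app (con b) (app (rename suc Y') (var zero)))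
  ⇛Pi-target p q = ⇛pi (⇛app ⇛con p) (⇛app ⇛con (⇛app (⇛-rename suc q) ⇛var))

  -- Left-hand sides are linear, and two contractions at the same root agree by functionality. The
  -- only nested overlap would be `app (con p) X`, inside a product redex, being a redex itself; the
  -- two disjointness conditions exclude it.
  diamond : ∀ {t u v} → t ⇛ u → t ⇛ v → ∃ λ w → u ⇛ w × v ⇛ w
  diamond ⇛var ⇛var = _ , ⇛var , ⇛var
  diamond ⇛con ⇛con = _ , ⇛con , ⇛con
  diamond (⇛pi p q) (⇛pi p' q') with diamond p p' | diamond q q'
  ... | _ , a , b | _ , c , d = _ , ⇛pi a c , ⇛pi b d
  diamond (⇛lam p q) (⇛lam p' q') with diamond p p' | diamond q q'
  ... | _ , a , b | _ , c , d = _ , ⇛lam a c , ⇛lam b d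
  diamond (⇛app p q) (⇛app p' q') with diamond p p' | diamond q q'
  ... | _ , a , b | _ , c , d = _ , ⇛app a c , ⇛app b d
  diamond (⇛app (⇛lam _ p) q) (⇛β p' q') with diamond p p' | diamond q q'
  ... | _ , a , b | _ , c , d = _ , ⇛β a c , ⇛-[] b d
  diamond (⇛app ⇛con ⇛con) (⇛ax r) = _ , ⇛ax r , ⇛con
  diamond (⇛app ⇛con (⇛app (⇛app ⇛con p) q)) (⇛Pi r p' q') with diamond p p' | diamond q q'
  ... | _ , a , b | _ , c , d = _ , ⇛Pi r a c , ⇛Pi-target b d
  diamond (⇛app ⇛con (⇛app (⇛ax r') q)) (⇛Pi r p' q') = ⊥-elim (PiR-AxR-disjoint r r')
  diamond (⇛app ⇛con (⇛app (⇛Pi r' _ _) q)) (⇛Pi r p' q') = ⊥-elim (PiR-PiR-disjoint r r')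
  diamond (⇛β p q) (⇛app (⇛lam _ p') q') with diamond p p' | diamond q q'
  ... | _ , a , b | _ , c , d = _ , ⇛-[] a c , ⇛β b d
  diamond (⇛β p q) (⇛β p' q') with diamond p p' | diamond q q'
  ... | _ , a , b | _ , c , d = _ , ⇛-[] a c , ⇛-[] b d
  diamond (⇛ax r) (⇛app ⇛con ⇛con) = _ , ⇛con , ⇛ax r
  diamond (⇛ax r) (⇛ax r') with AxR-functional r r'
  ... | refl = _ , ⇛con , ⇛con
  diamond (⇛Pi r p q) (⇛app ⇛con (⇛app (⇛app ⇛con p') q')) with diamond p p' | diamond q q'
  ... | _ , a , b | _ , c , d = _ , ⇛Pi-target a c , ⇛Pi r b d
  diamond (⇛Pi r p q) (⇛app ⇛con (⇛app (⇛ax r') q')) = ⊥-elim (PiR-AxR-disjoint r r')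
  diamond (⇛Pi r p q) (⇛app ⇛con (⇛app (⇛Pi r' _ _) q')) = ⊥-elim (PiR-PiR-disjoint r r')
  diamond (⇛Pi r p q) (⇛Pi r' p' q') with diamond p p' | diamond q q' | PiR-functional r r'
  ... | _ , a , b | _ , c , d | refl , refl = _ , ⇛Pi-target a c , ⇛Pi-target b d

  strip : ∀ {t u v} → t ⇛ u → t ⇛* v → ∃ λ w → u ⇛* w × v ⇛ w
  strip p ε = _ , ε , p
  strip p (q ◅ qs) with diamond p q
  ... | _ , a , b with strip b qs
  ...   | _ , c , d = _ , a ◅ c , d

  church-rosser-⇛ : ∀ {t u} → t ≃ u → ∃ λ w → t ⇛* w × u ⇛* w
  church-rosser-⇛ ε = _ , ε , ε
  church-rosser-⇛ (fwd s ◅ p) with church-rosser-⇛ p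
  ... | _ , a , b = _ , ⟶⇒⇛ s ◅ a , b
  church-rosser-⇛ (bwd s ◅ p) with church-rosser-⇛ p
  ... | _ , a , b with strip (⟶⇒⇛ s) a
  ...   | _ , c , d = _ , c , b ◅◅ (d ◅ ε)

  church-rosser : ∀ {t u} → t ≃ u → ∃ λ w → t ⟶* w × u ⟶* w
  church-rosser p with church-rosser-⇛ p
  ... | w , a , b = w , ⇛*⇒⟶* a , ⇛*⇒⟶* b

  con-⟶* : ∀ {c t} → con c ⟶* t → t ≡ con c
  con-⟶* ε = refl
  con-⟶* (top (root-β ()) ◅ _)

  pi-⟶* : ∀ {A B t} → pi A B ⟶* t → ∃ λ A' → ∃ λ B' → t ≡ pi A' B' × A ⟶* A' × B ⟶* B'
  pi-⟶* ε = _ , _ , refl , ε , ε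
  pi-⟶* (top (root-β ()) ◅ _)
  pi-⟶* (piL s ◅ p) with pi-⟶* p
  ... | _ , _ , e , a , b = _ , _ , e , s ◅ a , b
  pi-⟶* (piR s ◅ p) with pi-⟶* p
  ... | _ , _ , e , a , b = _ , _ , e , a , s ◅ b

  ≃-con⇒⟶* : ∀ {t c} → t ≃ con c → t ⟶* con c
  ≃-con⇒⟶* p with church-rosser p
  ... | _ , a , b with con-⟶* b
  ...   | refl = a

  ≃-pi⇒⟶* : ∀ {t A B} → t ≃ pi A B → ∃ λ A' → ∃ λ B' → t ⟶* pi A' B'
  ≃-pi⇒⟶* p with church-rosser p
  ... | _ , a , b with pi-⟶* b
  ...   | _ , _ , refl , _ = _ , _ , a

  ≃-con-injective : ∀ {c d} → con c ≃ con d → c ≡ d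
  ≃-con-injective p = sym (con-injective (con-⟶* (≃-con⇒⟶* p)))

  ≃-pi-injective : ∀ {A A' B B'} → pi A B ≃ pi A' B' → A ≃ A' × B ≃ B'
  ≃-pi-injective p with church-rosser p
  ... | _ , a , b with pi-⟶* a | pi-⟶* b
  ...   | _ , _ , refl , c , d | _ , _ , refl , c' , d' =
    ⟶*⇒≃ c ◅◅ ≃-sym (⟶*⇒≃ c') , ⟶*⇒≃ d ◅◅ ≃-sym (⟶*⇒≃ d')

  con≄pi : ∀ {c A B} → ¬ con c ≃ pi A B
  con≄pi p with pi-⟶* (≃-con⇒⟶* (≃-sym p))
  ... | _ , _ , () , _

-- Replacement of constants by closed terms

module ConstantSubstitution {C D : Set} (κ : C → Term D) (closed : ∀ c σ → subst σ (κ c) ≡ κ c) where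

  -- η-expansion of Π̇ and erasure to P both have this form. As the images are closed, nothing is
  -- renamed under binders.
  csub : Term C → Term D
  csub (var n)   = var n
  csub (con c)   = κ c
  csub (pi A B)  = pi (csub A) (csub B)
  csub (lam A t) = lam (csub A) (csub t)
  csub (app t u) = app (csub t) (csub u)

  csub-rename : ∀ ρ t → csub (rename ρ t) ≡ rename ρ (csub t)
  csub-rename ρ (var n)   = refl
  csub-rename ρ (con c)   = trans (sym (closed c _)) (subst-var (λ _ → refl) (κ c))
  csub-rename ρ (pi A B)  = cong₂ pi (csub-rename ρ A) (csub-rename _ B)
  csub-rename ρ (lam A t) = cong₂ lam (csub-rename ρ A) (csub-rename _ t)
  csub-rename ρ (app t u) = cong₂ app (csub-rename ρ t) (csub-rename ρ u)

  csub-exts : ∀ {σ τ} → (∀ n → csub (σ n) ≡ τ n) → ∀ n → csub (exts σ n) ≡ exts τ n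
  csub-exts h zero = refl
  csub-exts {σ} h (suc n) = trans (csub-rename suc (σ n)) (cong (rename suc) (h n))

  csub-subst : ∀ {σ τ} → (∀ n → csub (σ n) ≡ τ n) → ∀ t → csub (subst σ t) ≡ subst τ (csub t)
  csub-subst h (var n)   = h n
  csub-subst {τ = τ} h (con c) = sym (closed c τ)
  csub-subst h (pi A B)  = cong₂ pi (csub-subst h A) (csub-subst (csub-exts h) B)
  csub-subst h (lam A t) = cong₂ lam (csub-subst h A) (csub-subst (csub-exts h) t)
  csub-subst h (app t u) = cong₂ app (csub-subst h t) (csub-subst h u)

  csub-[] : ∀ t u → csub (t [ u ]) ≡ csub t [ csub u ]
  csub-[] t u = csub-subst h t
    where
    h : ∀ n → csub (sub0 u n) ≡ sub0 (csub u) n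
    h zero    = refl
    h (suc n) = refl

  module Conversion (R : Rules C) (R' : Rules D) where
    private
      module Src = Reduction R
    open Reduction R'

    csub-β : ∀ {t u} → Beta t u → csub t ≃ csub u
    csub-β (β A t u) = ⟶⇒≃ (top (root-β (β _ _ _))) ◅◅ ≡⇒≃ (sym (csub-[] t u))

    csub-Step : (∀ {t u} → Src.Root t u → csub t ≃ csub u) → ∀ {t u} → t Src.⟶₁ u → csub t ≃ csub u
    csub-Step h (top r)  = h r
    csub-Step h (piL s)  = ≃-pi (csub-Step h s) ε
    csub-Step h (piR s)  = ≃-pi ε (csub-Step h s)
    csub-Step h (lamL s) = ≃-lam (csub-Step h s) ε
    csub-Step h (lamR s) = ≃-lam ε (csub-Step h s)
    csub-Step h (appL s) = ≃-app (csub-Step h s) ε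
    csub-Step h (appR s) = ≃-app ε (csub-Step h s)

    csub-≃ : (∀ {t u} → Src.Root t u → csub t ≃ csub u) → ∀ {t u} → t Src.≃ u → csub t ≃ csub u
    csub-≃ h ε           = ε
    csub-≃ h (fwd s ◅ p) = csub-Step h s ◅◅ csub-≃ h p
    csub-≃ h (bwd s ◅ p) = ≃-sym (csub-Step h s) ◅◅ csub-≃ h p

-- Generic typing, uniqueness of types, validity

record Spec : Set₁ where
  field
    Const  : Set
    rules  : Rules Const
    Sig    : Const → Term Const → Set
    IsSort : Const → Set
    Rule   : Const → Const → Const → Set
    Sig-closed      : ∀ {c T} → Sig c T → ∀ σ → subst σ T ≡ T
    Sig-functional  : ∀ {c T T'} → Sig c T → Sig c T' → T ≡ T'
    Sig-shape       : ∀ {c T} → Sig c T → (∃ λ d → T ≡ con d) ⊎ (∃ λ A → ∃ λ B → T ≡ pi A B)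
    Rule-functional : ∀ {s₁ s₂ s₃ s₄} → Rule s₁ s₂ s₃ → Rule s₁ s₂ s₄ → s₃ ≡ s₄
    Rule-sorts      : ∀ {s₁ s₂ s₃} → Rule s₁ s₂ s₃ → IsSort s₁ × IsSort s₂ × IsSort s₃

-- Both P and λΠ_P are instances.  The conversion rule of the two systems asks
-- that both types have the same sort, which makes subject reduction awkward to
-- prove directly.  The flag Strict switches this requirement: it is present for
-- Strict = ⊤ and absent for Strict = ⊥.
module Typed (S : Spec) (Strict : Set) where
  open Spec S
  open Reduction rules public

  infix 3 _⊩_∶_

  mutual
    data Wf : Ctx {Const} → Set where
      wf-[] : Wf []
      wf-∷  : ∀ {Γ A s} → IsSort s → Γ ⊩ A ∶ con s → Wf (A ∷ Γ)

    data _⊩_∶_ : Ctx {Const} → Term Const → Term Const → Set where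
      t-con  : ∀ {Γ c T} → Wf Γ → Sig c T → Γ ⊩ con c ∶ T
      t-var  : ∀ {Γ n A} → Wf Γ → Γ ∋ n ⦂ A → Γ ⊩ var n ∶ A
      t-pi   : ∀ {Γ A B s₁ s₂ s₃} → Rule s₁ s₂ s₃ → Γ ⊩ A ∶ con s₁ → A ∷ Γ ⊩ B ∶ con s₂ →
               Γ ⊩ pi A B ∶ con s₃
      t-lam  : ∀ {Γ A B t s₁ s₂ s₃} → Rule s₁ s₂ s₃ → Γ ⊩ A ∶ con s₁ → A ∷ Γ ⊩ B ∶ con s₂ →
               A ∷ Γ ⊩ t ∶ B → Γ ⊩ lam A t ∶ pi A B
      t-app  : ∀ {Γ t u A B} → Γ ⊩ t ∶ pi A B → Γ ⊩ u ∶ A → Γ ⊩ app t u ∶ B [ u ]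
      t-conv : ∀ {Γ t A B s} → IsSort s → Γ ⊩ t ∶ A → (Strict → Γ ⊩ A ∶ con s) →
               Γ ⊩ B ∶ con s → A ≃ B → Γ ⊩ t ∶ B

  ⊩-≡ : ∀ {Γ t A B} → Γ ⊩ t ∶ A → A ≡ B → Γ ⊩ t ∶ B
  ⊩-≡ d refl = d

  ⊩⇒Wf : ∀ {Γ t A} → Γ ⊩ t ∶ A → Wf Γ
  ⊩⇒Wf (t-con w _)          = w
  ⊩⇒Wf (t-var w _)          = w
  ⊩⇒Wf (t-pi _ d _)         = ⊩⇒Wf d
  ⊩⇒Wf (t-lam _ d _ _)      = ⊩⇒Wf d
  ⊩⇒Wf (t-app d _)          = ⊩⇒Wf d
  ⊩⇒Wf (t-conv _ d _ _ _)   = ⊩⇒Wf d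

  Rename : (ℕ → ℕ) → Ctx {Const} → Ctx {Const} → Set
  Rename ρ Γ Δ = ∀ {n A} → Γ ∋ n ⦂ A → Δ ∋ ρ n ⦂ rename ρ A

  Rename-ext : ∀ {ρ Γ Δ A} → Rename ρ Γ Δ → Rename (ext {Const} ρ) (A ∷ Γ) (rename ρ A ∷ Δ)
  Rename-ext {ρ} r (here {A = A}) =
    transport (_∋_⦂_ _ _) (sym (rename-wk ρ A)) here
  Rename-ext {ρ} r (there {A = A} x) =
    transport (_∋_⦂_ _ _) (sym (rename-wk ρ A)) (there (r x))

  Sig-closed-rename : ∀ {c T} → Sig c T → ∀ ρ → rename ρ T ≡ T
  Sig-closed-rename {T = T} s ρ = trans (sym (subst-var (λ _ → refl) T)) (Sig-closed s _)

  ⊩-rename : ∀ {ρ Γ Δ t A} → Γ ⊩ t ∶ A → Wf Δ → Rename ρ Γ Δ → Δ ⊩ rename ρ t ∶ rename ρ A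
  ⊩-rename {ρ} (t-con _ s) w r = ⊩-≡ (t-con w s) (sym (Sig-closed-rename s ρ))
  ⊩-rename (t-var _ x) w r = t-var w (r x)
  ⊩-rename (t-pi R d e) w r =
    t-pi R d' (⊩-rename e (wf-∷ (proj₁ (Rule-sorts R)) d') (Rename-ext r))
    where d' = ⊩-rename d w r
  ⊩-rename (t-lam R d e f) w r =
    t-lam R d' (⊩-rename e w' (Rename-ext r)) (⊩-rename f w' (Rename-ext r))
    where
    d' = ⊩-rename d w r
    w' = wf-∷ (proj₁ (Rule-sorts R)) d'
  ⊩-rename {ρ} (t-app {u = u} {B = B} d e) w r =
    ⊩-≡ (t-app (⊩-rename d w r) (⊩-rename e w r)) (sym (rename-[] ρ B u))
  ⊩-rename {ρ} (t-conv i d c e p) w r =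
    t-conv i (⊩-rename d w r) (λ x → ⊩-rename (c x) w r) (⊩-rename e w r) (≃-rename ρ p)

  ⊩-wk : ∀ {Γ t A B s} → IsSort s → Γ ⊩ B ∶ con s → Γ ⊩ t ∶ A →
         B ∷ Γ ⊩ rename suc t ∶ rename suc A
  ⊩-wk i b d = ⊩-rename d (wf-∷ i b) there

  Substitution : (ℕ → Term Const) → Ctx {Const} → Ctx {Const} → Set
  Substitution σ Γ Δ = ∀ {n A} → Γ ∋ n ⦂ A → Δ ⊩ σ n ∶ subst σ A

  Substitution-exts : ∀ {σ Γ Δ A s} → Substitution σ Γ Δ → IsSort s → Δ ⊩ subst σ A ∶ con s →
                      Substitution (exts σ) (A ∷ Γ) (subst σ A ∷ Δ)
  Substitution-exts {σ} r i d (here {A = A}) =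
    ⊩-≡ (t-var (wf-∷ i d) here) (sym (subst-wk σ A))
  Substitution-exts {σ} r i d (there {A = A} x) =
    ⊩-≡ (⊩-wk i d (r x)) (sym (subst-wk σ A))

  ⊩-subst : ∀ {σ Γ Δ t A} → Γ ⊩ t ∶ A → Wf Δ → Substitution σ Γ Δ → Δ ⊩ subst σ t ∶ subst σ A
  ⊩-subst {σ} (t-con _ s) w r = ⊩-≡ (t-con w s) (sym (Sig-closed s σ))
  ⊩-subst (t-var _ x) w r = r x
  ⊩-subst (t-pi R d e) w r =
    t-pi R d' (⊩-subst e (wf-∷ i d') (Substitution-exts r i d'))
    where
    d' = ⊩-subst d w r
    i  = proj₁ (Rule-sorts R)
  ⊩-subst (t-lam R d e f) w r =
    t-lam R d' (⊩-subst e w' (Substitution-exts r i d')) (⊩-subst f w' (Substitution-exts r i d'))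
    where
    d' = ⊩-subst d w r
    i  = proj₁ (Rule-sorts R)
    w' = wf-∷ i d'
  ⊩-subst {σ} (t-app {u = u} {B = B} d e) w r =
    ⊩-≡ (t-app (⊩-subst d w r) (⊩-subst e w r)) (sym (subst-[] σ B u))
  ⊩-subst {σ} (t-conv i d c e p) w r =
    t-conv i (⊩-subst d w r) (λ x → ⊩-subst (c x) w r) (⊩-subst e w r) (≃-subst σ p)

  ⊩-[] : ∀ {Γ t u A B} → A ∷ Γ ⊩ t ∶ B → Γ ⊩ u ∶ A → Γ ⊩ t [ u ] ∶ B [ u ]
  ⊩-[] {Γ} {u = u} {A = A} d e = ⊩-subst d (⊩⇒Wf e) h
    where
    h : Substitution (sub0 u) (A ∷ Γ) Γ
    h here              = ⊩-≡ e (sym (wk-[] A u))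
    h (there {A = B} x) = ⊩-≡ (t-var (⊩⇒Wf e) x) (sym (wk-[] B u))

  inv-con : ∀ {Γ c T} → Γ ⊩ con c ∶ T → ∃ λ T' → Sig c T' × T' ≃ T
  inv-con (t-con _ s) = _ , s , ε
  inv-con (t-conv _ d _ _ p) with inv-con d
  ... | _ , s , q = _ , s , q ◅◅ p

  inv-var : ∀ {Γ n T} → Γ ⊩ var n ∶ T → ∃ λ A → Γ ∋ n ⦂ A × A ≃ T
  inv-var (t-var _ x) = _ , x , ε
  inv-var (t-conv _ d _ _ p) with inv-var d
  ... | _ , x , q = _ , x , q ◅◅ p

  inv-pi : ∀ {Γ A B T} → Γ ⊩ pi A B ∶ T → ∃ λ s₁ → ∃ λ s₂ → ∃ λ s₃ →
           Rule s₁ s₂ s₃ × Γ ⊩ A ∶ con s₁ × A ∷ Γ ⊩ B ∶ con s₂ × con s₃ ≃ T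
  inv-pi (t-pi R d e) = _ , _ , _ , R , d , e , ε
  inv-pi (t-conv _ d _ _ p) with inv-pi d
  ... | _ , _ , _ , R , d' , e' , q = _ , _ , _ , R , d' , e' , q ◅◅ p

  inv-lam : ∀ {Γ A t T} → Γ ⊩ lam A t ∶ T → ∃ λ s₁ → ∃ λ s₂ → ∃ λ s₃ → ∃ λ B →
            Rule s₁ s₂ s₃ × Γ ⊩ A ∶ con s₁ × A ∷ Γ ⊩ B ∶ con s₂ × A ∷ Γ ⊩ t ∶ B × pi A B ≃ T
  inv-lam (t-lam R d e f) = _ , _ , _ , _ , R , d , e , f , ε
  inv-lam (t-conv _ d _ _ p) with inv-lam d
  ... | _ , _ , _ , _ , R , d' , e' , f' , q = _ , _ , _ , _ , R , d' , e' , f' , q ◅◅ p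

  inv-app : ∀ {Γ t u T} → Γ ⊩ app t u ∶ T → ∃ λ A → ∃ λ B →
            Γ ⊩ t ∶ pi A B × Γ ⊩ u ∶ A × B [ u ] ≃ T
  inv-app (t-app d e) = _ , _ , d , e , ε
  inv-app (t-conv _ d _ _ p) with inv-app d
  ... | _ , _ , d' , e' , q = _ , _ , d' , e' , q ◅◅ p

  ∋-functional : ∀ {Γ : Ctx {Const}} {n A B} → Γ ∋ n ⦂ A → Γ ∋ n ⦂ B → A ≡ B
  ∋-functional here here = refl
  ∋-functional (there x) (there y) = cong (rename suc) (∋-functional x y)

  -- Recursion is on the term, so that inversion absorbs all conversion steps. Confluence enters
  -- through injectivity: of constants, to identify the sorts of a product's components, and of
  -- products, to compare codomains in an application.
  ⊩-functional : ∀ {Γ} t {A B} → Γ ⊩ t ∶ A → Γ ⊩ t ∶ B → A ≃ B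
  ⊩-functional (var n) d e with inv-var d | inv-var e
  ... | _ , x , p | _ , y , q = ≃-sym p ◅◅ ≡⇒≃ (∋-functional x y) ◅◅ q
  ⊩-functional (con c) d e with inv-con d | inv-con e
  ... | _ , x , p | _ , y , q = ≃-sym p ◅◅ ≡⇒≃ (Sig-functional x y) ◅◅ q
  ⊩-functional (pi A B) d e with inv-pi d | inv-pi e
  ... | _ , _ , _ , R , a , b , p | _ , _ , _ , R' , a' , b' , q
      with ≃-con-injective (⊩-functional A a a') | ≃-con-injective (⊩-functional B b b')
  ...   | refl | refl = ≃-sym p ◅◅ ≡⇒≃ (cong con (Rule-functional R R')) ◅◅ q
  ⊩-functional (lam A t) d e with inv-lam d | inv-lam e
  ... | _ , _ , _ , _ , _ , _ , _ , b , p | _ , _ , _ , _ , _ , _ , _ , b' , q =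
    ≃-sym p ◅◅ ≃-pi ε (⊩-functional t b b') ◅◅ q
  ⊩-functional (app t u) d e with inv-app d | inv-app e
  ... | _ , _ , a , b , p | _ , _ , a' , b' , q =
    ≃-sym p ◅◅ ≃-[] (proj₂ (≃-pi-injective (⊩-functional t a a'))) ε ◅◅ q

  -- The first alternative accounts for top sorts, such as `Kind`, which have no type.
  Valid : Ctx {Const} → Term Const → Set
  Valid Γ T = (∃ λ s → IsSort s × T ≡ con s) ⊎ (∃ λ s → IsSort s × Γ ⊩ T ∶ con s)

  -- Kept outside `Spec` because it mentions the typing judgement, which is built over a `Spec`.
  Sig-Valid : Set
  Sig-Valid = ∀ {Γ c T} → Wf Γ → Sig c T → Valid Γ T

  ∋-valid : ∀ {Γ n A} → Wf Γ → Γ ∋ n ⦂ A → ∃ λ s → IsSort s × Γ ⊩ A ∶ con s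
  ∋-valid (wf-∷ i d) here = _ , i , ⊩-wk i d d
  ∋-valid (wf-∷ i d) (there x) with ∋-valid (⊩⇒Wf d) x
  ... | _ , j , e = _ , j , ⊩-wk i d e

  module Validity (sig-valid : Sig-Valid) where

    ⊩-valid : ∀ {Γ t A} → Γ ⊩ t ∶ A → Valid Γ A
    ⊩-valid (t-con w s)         = sig-valid w s
    ⊩-valid (t-var w x)         = inj₂ (∋-valid w x)
    ⊩-valid (t-pi R _ _)        = inj₁ (_ , proj₂ (proj₂ (Rule-sorts R)) , refl)
    ⊩-valid (t-lam R d e _)     = inj₂ (_ , proj₂ (proj₂ (Rule-sorts R)) , t-pi R d e)
    ⊩-valid (t-app d e) with ⊩-valid d
    ... | inj₂ (_ , _ , f) with inv-pi f
    ...   | _ , _ , _ , R , _ , b , _ = inj₂ (_ , proj₁ (proj₂ (Rule-sorts R)) , ⊩-[] b e)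
    ⊩-valid (t-conv i _ _ e _)  = inj₂ (_ , i , e)

    pi-valid : ∀ {Γ t A B} → Γ ⊩ t ∶ pi A B → ∃ λ s₁ → ∃ λ s₂ → ∃ λ s₃ →
               Rule s₁ s₂ s₃ × Γ ⊩ A ∶ con s₁ × A ∷ Γ ⊩ B ∶ con s₂
    pi-valid d with ⊩-valid d
    ... | inj₂ (_ , _ , f) with inv-pi f
    ...   | _ , _ , _ , R , a , b , _ = _ , _ , _ , R , a , b

-- Subject reduction and recovery of the strict conversion rule

module Relaxed (S : Spec) (sig-valid : Typed.Sig-Valid S ⊥) where
  open Spec S
  open Rules rules
  open Typed S ⊥ public
  open Validity sig-valid public

  -- Under the strict rule, the β case of subject reduction would need convertible types to have
  -- equal sorts, a fact that itself comes from subject reduction. The relaxed rule breaks this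
  -- circle.
  conv : ∀ {Γ t A B s} → IsSort s → Γ ⊩ t ∶ A → Γ ⊩ B ∶ con s → A ≃ B → Γ ⊩ t ∶ B
  conv i d e p = t-conv i d (λ ()) e p

  -- The identity is a well-typed substitution between the two contexts once the changed variable is
  -- retyped by conversion.
  ⊩-ctx-conv : ∀ {Γ t A A' T s} → IsSort s → A' ≃ A → Γ ⊩ A' ∶ con s →
               A ∷ Γ ⊩ t ∶ T → A' ∷ Γ ⊩ t ∶ T
  ⊩-ctx-conv {Γ} {t} {A} {A'} {T} i p d e with ⊩⇒Wf e
  ... | wf-∷ j a = transport (λ u → A' ∷ Γ ⊩ u ∶ T) (subst-id (λ _ → refl) t)
                     (⊩-≡ (⊩-subst e (wf-∷ i d) h) (subst-id (λ _ → refl) T))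
    where
    h : Substitution var (A ∷ Γ) (A' ∷ Γ)
    h here =
      ⊩-≡ (conv j (t-var (wf-∷ i d) here) (⊩-wk i d a) (≃-rename suc p)) (sym (subst-id (λ _ → refl) _))
    h (there x) = ⊩-≡ (t-var (wf-∷ i d) (there x)) (sym (subst-id (λ _ → refl) _))

  -- A type convertible to a constant is handled separately because a sort
  -- need not be typable.
  conv-con : ∀ {Γ t t' c T} → Γ ⊩ t ∶ con c → con c ≃ T → Γ ⊩ t' ∶ T → Γ ⊩ t ∶ T
  conv-con d p e with ⊩-valid e
  ... | inj₁ (_ , _ , refl) = ⊩-≡ d (cong con (≃-con-injective p))
  ... | inj₂ (_ , i , f)    = conv i d f p

  record Preserves : Set where
    field
      ax-preserves : ∀ {Γ e d u T} → AxR e d u → Γ ⊩ app (con e) (con d) ∶ T → Γ ⊩ con u ∶ T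
      pi-preserves : ∀ {Γ e p a b X Y T} → PiR e p a b →
        Γ ⊩ app (con e) (app (app (con p) X) Y) ∶ T →
        Γ ⊩ pi (app (con a) X) (app (con b) (app (rename suc Y) (var zero))) ∶ T

  module SubjectReduction (preserves : Preserves) where
    open Preserves preserves

    subject-reduction : ∀ {Γ t u T} → Γ ⊩ t ∶ T → t ⟶₁ u → Γ ⊩ u ∶ T
    subject-reduction (t-con _ _) (top (root-β ()))
    subject-reduction (t-var _ _) (top (root-β ()))
    subject-reduction (t-pi _ _ _) (top (root-β ()))
    subject-reduction (t-pi R d e) (piL s) =
      t-pi R d' (⊩-ctx-conv (proj₁ (Rule-sorts R)) (≃-sym (⟶⇒≃ s)) d' e)
      where d' = subject-reduction d s
    subject-reduction (t-pi R d e) (piR s) = t-pi R d (subject-reduction e s)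
    subject-reduction (t-lam _ _ _ _) (top (root-β ()))
    subject-reduction (t-lam R d e f) (lamL s) =
      conv (proj₂ (proj₂ (Rule-sorts R))) (t-lam R d' (c e) (c f)) (t-pi R d e) (≃-pi (≃-sym (⟶⇒≃ s)) ε)
      where
      d' = subject-reduction d s
      c : ∀ {t T} → _ ∷ _ ⊩ t ∶ T → _ ∷ _ ⊩ t ∶ T
      c = ⊩-ctx-conv (proj₁ (Rule-sorts R)) (≃-sym (⟶⇒≃ s)) d'
    subject-reduction (t-lam R d e f) (lamR s) = t-lam R d e (subject-reduction f s)
    subject-reduction (t-app d e) (appL s) = t-app (subject-reduction d s) e
    subject-reduction (t-app {B = B} d e) (appR s) with pi-valid d
    ... | _ , _ , _ , R , _ , b =
      conv (proj₁ (proj₂ (Rule-sorts R))) (t-app d (subject-reduction e s)) (⊩-[] b e)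
           (≃-[] (ε {x = B}) (≃-sym (⟶⇒≃ s)))
    subject-reduction (t-app d e) (top (root-β (β A t u))) with pi-valid d | inv-lam d
    ... | _ , _ , _ , R , _ , b | _ , _ , _ , _ , R' , a' , b' , t' , p with ≃-pi-injective p
    ...   | q , r =
      conv (proj₁ (proj₂ (Rule-sorts R))) (⊩-[] t' (conv (proj₁ (Rule-sorts R')) e a' (≃-sym q)))
           (⊩-[] b e) (≃-[] r ε)
    subject-reduction d@(t-app _ _) (top (root-ax r))     = ax-preserves r d
    subject-reduction d@(t-app _ _) (top (root-pi X Y r)) = pi-preserves r d
    subject-reduction (t-conv i d c e p) s = t-conv i (subject-reduction d s) c e p

    subject-reduction* : ∀ {Γ t u T} → Γ ⊩ t ∶ T → t ⟶* u → Γ ⊩ u ∶ T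
    subject-reduction* d ε        = d
    subject-reduction* d (s ◅ ss) = subject-reduction* (subject-reduction d s) ss

    ⊩-functional-≃ : ∀ {Γ t u A B} → t ≃ u → Γ ⊩ t ∶ A → Γ ⊩ u ∶ B → A ≃ B
    ⊩-functional-≃ p d e with church-rosser p
    ... | _ , a , b = ⊩-functional _ (subject-reduction* d a) (subject-reduction* e b)

    -- A target sort need not come with a typing. If the source type has one, it reduces to that
    -- sort, which then inherits the typing; otherwise both sides are sorts, hence equal.
    conv-valid : ∀ {Γ t A B} → Γ ⊩ t ∶ A → Valid Γ B → A ≃ B → Γ ⊩ t ∶ B
    conv-valid d (inj₂ (_ , i , e)) p = conv i d e p
    conv-valid d (inj₁ (_ , _ , refl)) p with ⊩-valid d
    ... | inj₁ (_ , _ , refl) = ⊩-≡ d (cong con (≃-con-injective p))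
    ... | inj₂ (_ , i , e)    = conv i d (subject-reduction* e (≃-con⇒⟶* p)) p

    -- Uniqueness of types makes the sorts of convertible types agree, so the
    -- strict conversion rule is always applicable.
    module Strictness (sig-valid⊤ : Typed.Sig-Valid S ⊤) where
      private
        module Str = Typed S ⊤
        module StrV = Str.Validity sig-valid⊤

      mutual
        relax-Wf : ∀ {Γ} → Str.Wf Γ → Wf Γ
        relax-Wf Str.wf-[]      = wf-[]
        relax-Wf (Str.wf-∷ i d) = wf-∷ i (relax d)

        relax : ∀ {Γ t A} → Γ Str.⊩ t ∶ A → Γ ⊩ t ∶ A
        relax (Str.t-con w s)        = t-con (relax-Wf w) s
        relax (Str.t-var w x)        = t-var (relax-Wf w) x
        relax (Str.t-pi R d e)       = t-pi R (relax d) (relax e)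
        relax (Str.t-lam R d e f)    = t-lam R (relax d) (relax e) (relax f)
        relax (Str.t-app d e)        = t-app (relax d) (relax e)
        relax (Str.t-conv i d _ e p) = conv i (relax d) (relax e) p

      strict-conv : ∀ {Γ t A B s} → IsSort s → Γ Str.⊩ t ∶ A → Γ Str.⊩ B ∶ con s → A ≃ B → Γ Str.⊩ t ∶ B
      strict-conv i d e p with StrV.⊩-valid d
      ... | inj₂ (_ , _ , f) with ≃-con-injective (⊩-functional-≃ p (relax f) (relax e))
      ...   | refl = Str.t-conv i d (λ _ → f) e p
      -- The source type is a sort with no typing at hand. The target reduces to it, so it has a
      -- signature type convertible to `con s`; `Sig-shape` makes that type a constant, thus `con s`
      -- itself.
      strict-conv i d e p | inj₁ (_ , _ , refl)
        with inv-con (subject-reduction* (relax e) (≃-con⇒⟶* (≃-sym p)))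
      ... | _ , s , q with Sig-shape s
      ...   | inj₂ (_ , _ , refl) = ⊥-elim (con≄pi (≃-sym q))
      ...   | inj₁ (_ , refl) with ≃-con-injective q
      ...     | refl = Str.t-conv i d (λ _ → Str.t-con (Str.⊩⇒Wf d) s) e p

      mutual
        strict-Wf : ∀ {Γ} → Wf Γ → Str.Wf Γ
        strict-Wf wf-[]      = Str.wf-[]
        strict-Wf (wf-∷ i d) = Str.wf-∷ i (strict d)

        strict : ∀ {Γ t A} → Γ ⊩ t ∶ A → Γ Str.⊩ t ∶ A
        strict (t-con w s)        = Str.t-con (strict-Wf w) s
        strict (t-var w x)        = Str.t-var (strict-Wf w) x
        strict (t-pi R d e)       = Str.t-pi R (strict d) (strict e)
        strict (t-lam R d e f)    = Str.t-lam R (strict d) (strict e) (strict f)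
        strict (t-app d e)        = Str.t-app (strict d) (strict e)
        strict (t-conv i d _ e p) = strict-conv i (strict d) (strict e) p

-- P and λΠ_P as instances of the generic system

module _ (P : PTS) (functional : Functional P) where
  open PTS P
  open Typing P

  data PSig : Sort → PTerm → Set where
    psig : ∀ {s₁ s₂} → Ax s₁ s₂ → PSig s₁ (con s₂)

  βRules : Rules Sort
  βRules = record
    { AxR = λ _ _ _ → ⊥
    ; PiR = λ _ _ _ _ → ⊥
    ; AxR-functional = λ ()
    ; PiR-functional = λ ()
    ; PiR-AxR-disjoint = λ ()
    ; PiR-PiR-disjoint = λ ()
    }

  PSpec : Spec
  PSpec = record
    { Const = Sort
    ; rules = βRules
    ; Sig = PSig
    ; IsSort = λ _ → ⊤
    ; Rule = Rl
    ; Sig-closed = λ { (psig _) _ → refl }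
    ; Sig-functional = λ { (psig a) (psig b) → cong con (proj₁ functional a b) }
    ; Sig-shape = λ { (psig _) → inj₁ (_ , refl) }
    ; Rule-functional = proj₂ functional
    ; Rule-sorts = λ _ → _
    }

  data LAx : LConst Sort → LConst Sort → LConst Sort → Set where
    lax : ∀ {s₁ s₂} → Ax s₁ s₂ → LAx (eps s₂) (dot s₁ s₂) (U s₁)

  data LPi : LConst Sort → LConst Sort → LConst Sort → LConst Sort → Set where
    lpi : ∀ {s₁ s₂ s₃} → Rl s₁ s₂ s₃ → LPi (eps s₃) (dotPi s₁ s₂ s₃) (eps s₁) (eps s₂)

  LRules : Rules (LConst Sort)
  LRules = record
    { AxR = LAx
    ; PiR = LPi
    ; AxR-functional = λ { (lax _) (lax _) → refl }
    ; PiR-functional = λ { (lpi _) (lpi _) → refl , refl }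
    ; PiR-AxR-disjoint = λ { (lpi _) () }
    ; PiR-PiR-disjoint = λ { (lpi _) () }
    }

  data LSig : LConst Sort → LTerm → Set where
    lsig-Type : LSig Type (con Kind)
    lsig      : ∀ {c T} → SigType c T → LSig c T

  data LIsSort : LConst Sort → Set where
    type : LIsSort Type
    kind : LIsSort Kind

  data LRule : LConst Sort → LConst Sort → LConst Sort → Set where
    lrule : ∀ {s} → LIsSort s → LRule Type s s

  SigType-closed : ∀ {c T} → SigType c T → ∀ σ → subst σ T ≡ T
  SigType-closed (sig-U _)     σ = refl
  SigType-closed (sig-eps _)   σ = refl
  SigType-closed (sig-dot _)   σ = refl
  SigType-closed (sig-dotPi _) σ = refl

  LSig-functional : ∀ {c T T'} → LSig c T → LSig c T' → T ≡ T'
  LSig-functional lsig-Type            lsig-Type            = refl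
  LSig-functional (lsig (sig-U _))     (lsig (sig-U _))     = refl
  LSig-functional (lsig (sig-eps _))   (lsig (sig-eps _))   = refl
  LSig-functional (lsig (sig-dot _))   (lsig (sig-dot _))   = refl
  LSig-functional (lsig (sig-dotPi _)) (lsig (sig-dotPi _)) = refl

  LSig-shape : ∀ {c T} → LSig c T → (∃ λ d → T ≡ con d) ⊎ (∃ λ A → ∃ λ B → T ≡ pi A B)
  LSig-shape lsig-Type            = inj₁ (_ , refl)
  LSig-shape (lsig (sig-U _))     = inj₁ (_ , refl)
  LSig-shape (lsig (sig-eps _))   = inj₂ (_ , _ , refl)
  LSig-shape (lsig (sig-dot _))   = inj₁ (_ , refl)
  LSig-shape (lsig (sig-dotPi _)) = inj₂ (_ , _ , refl)

  LSpec : Spec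
  LSpec = record
    { Const = LConst Sort
    ; rules = LRules
    ; Sig = LSig
    ; IsSort = LIsSort
    ; Rule = LRule
    ; Sig-closed = λ { lsig-Type _ → refl ; (lsig s) σ → SigType-closed s σ }
    ; Sig-functional = LSig-functional
    ; Sig-shape = LSig-shape
    ; Rule-functional = λ { (lrule _) (lrule _) → refl }
    ; Rule-sorts = λ { (lrule i) → type , i , i }
    }

  P-sig-valid : ∀ Strict → Typed.Sig-Valid PSpec Strict
  P-sig-valid _ _ (psig _) = inj₁ (_ , tt , refl)

  module LTyping (Strict : Set) where
    open Typed LSpec Strict

    ⊩U : ∀ {Γ s} → Wf Γ → Γ ⊩ con (U s) ∶ con Type
    ⊩U w = t-con w (lsig (sig-U _))

    ⊩eps : ∀ {Γ s a} → Γ ⊩ a ∶ con (U s) → Γ ⊩ app (con (eps s)) a ∶ con Type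
    ⊩eps d = t-app (t-con (⊩⇒Wf d) (lsig (sig-eps _))) d

    L-sig-valid : Sig-Valid
    L-sig-valid w lsig-Type          = inj₁ (_ , kind , refl)
    L-sig-valid w (lsig (sig-U s))   = inj₁ (_ , type , refl)
    L-sig-valid w (lsig (sig-eps s)) =
      inj₂ (_ , kind , t-pi (lrule kind) (⊩U w) (t-con (wf-∷ type (⊩U w)) lsig-Type))
    L-sig-valid w (lsig (sig-dot _)) = inj₂ (_ , type , ⊩U w)
    L-sig-valid {Γ} w (lsig (sig-dotPi {s₁} {s₂} _)) =
      inj₂ (_ , type , t-pi (lrule type) (⊩U w) (t-pi (lrule type) arr (⊩U (wf-∷ type arr))))
      where
      w₁ : Wf (con (U s₁) ∷ Γ)
      w₁ = wf-∷ type (⊩U w)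
      arr : con (U s₁) ∷ Γ ⊩ pi (app (con (eps s₁)) (var zero)) (con (U s₂)) ∶ con Type
      arr = t-pi (lrule type) (⊩eps (t-var w₁ here)) (⊩U (wf-∷ type (⊩eps (t-var w₁ here))))

  open LTyping using (L-sig-valid)
  open LTyping ⊥ using (⊩U; ⊩eps)
  open Relaxed LSpec (L-sig-valid ⊥)

  inv-eps : ∀ {Γ s a T} → Γ ⊩ app (con (eps s)) a ∶ T → Γ ⊩ a ∶ con (U s) × con Type ≃ T
  inv-eps d with inv-app d
  ... | _ , _ , e , f , p with inv-con e
  ...   | _ , lsig (sig-eps _) , q with ≃-pi-injective q
  ...     | q₁ , q₂ = conv type f (⊩U (⊩⇒Wf d)) (≃-sym q₁) , ≃-[] q₂ ε ◅◅ p

  inv-dot : ∀ {Γ s₁ s₂ T} → Γ ⊩ con (dot s₁ s₂) ∶ T → Ax s₁ s₂ × con (U s₂) ≃ T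
  inv-dot d with inv-con d
  ... | _ , lsig (sig-dot r) , p = r , p

  inv-dotPi : ∀ {Γ s₁ s₂ s₃ X Y T} → Γ ⊩ app (app (con (dotPi s₁ s₂ s₃)) X) Y ∶ T →
              Rl s₁ s₂ s₃ × Γ ⊩ X ∶ con (U s₁) ×
              Γ ⊩ Y ∶ pi (app (con (eps s₁)) X) (con (U s₂)) × con (U s₃) ≃ T
  inv-dotPi d with inv-app d
  ... | _ , _ , e , f , p with inv-app e
  ...   | _ , _ , e' , f' , p' with inv-con e'
  ...     | _ , lsig (sig-dotPi R) , q with ≃-pi-injective q
  ...       | q₁ , q₂ with ≃-pi-injective (≃-[] q₂ ε ◅◅ p')
  ...         | r₁ , r₂ = R , x , conv type f arr (≃-sym r₁) , ≃-[] r₂ ε ◅◅ p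
    where
    x   = conv type f' (⊩U (⊩⇒Wf d)) (≃-sym q₁)
    arr = t-pi (lrule type) (⊩eps x) (⊩U (wf-∷ type (⊩eps x)))

  inv-dotPi-lam : ∀ {Γ s₁ s₂ s₃ X c b T} → Γ ⊩ app (app (con (dotPi s₁ s₂ s₃)) X) (lam c b) ∶ T →
                  Rl s₁ s₂ s₃ × Γ ⊩ X ∶ con (U s₁) × c ≃ app (con (eps s₁)) X ×
                  c ∷ Γ ⊩ b ∶ con (U s₂) × con (U s₃) ≃ T
  inv-dotPi-lam d with inv-dotPi d
  ... | R , x , y , p with inv-lam y
  ...   | _ , _ , _ , _ , lrule _ , c , _ , b , q with ≃-pi-injective q
  ...     | q₁ , q₂ = R , x , q₁ , conv type b (⊩U (⊩⇒Wf b)) q₂ , p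

  L-preserves : Preserves
  L-preserves = record { ax-preserves = ax ; pi-preserves = pi' }
    where
    ax : ∀ {Γ e d u T} → LAx e d u → Γ ⊩ app (con e) (con d) ∶ T → Γ ⊩ con u ∶ T
    ax (lax _) d = conv-con (⊩U (⊩⇒Wf d)) (proj₂ (inv-eps d)) d

    pi' : ∀ {Γ e p a b X Y T} → LPi e p a b → Γ ⊩ app (con e) (app (app (con p) X) Y) ∶ T →
          Γ ⊩ pi (app (con a) X) (app (con b) (app (rename suc Y) (var zero))) ∶ T
    pi' (lpi _) d with inv-eps d
    ... | e , p with inv-dotPi e
    ...   | _ , x , y , _ =
      conv-con (t-pi (lrule type) (⊩eps x)
                 (⊩eps (t-app (⊩-wk type (⊩eps x) y) (t-var (wf-∷ type (⊩eps x)) here)))) p d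

  open SubjectReduction L-preserves

  private
    module Pr = Relaxed PSpec (P-sig-valid ⊥)

  P-preserves : Pr.Preserves
  P-preserves = record { ax-preserves = λ () ; pi-preserves = λ () }

  private
    module PSR = Pr.SubjectReduction P-preserves
    module PStr = PSR.Strictness (P-sig-valid ⊤)
    module PS = Typed PSpec ⊤
    module LStr = Strictness (L-sig-valid ⊤)
    module LS = Typed LSpec ⊤

  -- Passage between the given judgements and the generic ones

  ≡β⇒≃ : ∀ {t u} → t ≡β u → t Pr.≃ u
  ≡β⇒≃ = Equivalence.map (Step-map Pr.root-β)

  ≃⇒≡β : ∀ {t u} → t Pr.≃ u → t ≡β u
  ≃⇒≡β = Equivalence.map (Step-map λ { (Pr.root-β b) → b })

  Rw⇒Root : ∀ {t u} → Rw t u → Root t u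
  Rw⇒Root (rw-β b)      = root-β b
  Rw⇒Root (rw-ax a)     = root-ax (lax a)
  Rw⇒Root (rw-pi X Y r) = root-pi X Y (lpi r)

  Root⇒Rw : ∀ {t u} → Root t u → Rw t u
  Root⇒Rw (root-β b)            = rw-β b
  Root⇒Rw (root-ax (lax a))     = rw-ax a
  Root⇒Rw (root-pi X Y (lpi r)) = rw-pi X Y r

  mutual
    P-Wf-in : ∀ {Γ} → WF Γ → PS.Wf Γ
    P-Wf-in wf-nil      = PS.wf-[]
    P-Wf-in (wf-cons d) = PS.wf-∷ tt (P-strict-in d)

    P-strict-in : ∀ {Γ t A} → Γ ⊢ t ∶ A → Γ PS.⊩ t ∶ A
    P-strict-in (⊢sort w a)       = PS.t-con (P-Wf-in w) (psig a)
    P-strict-in (⊢var w x)        = PS.t-var (P-Wf-in w) x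
    P-strict-in (⊢pi d e R)       = PS.t-pi R (P-strict-in d) (P-strict-in e)
    P-strict-in (⊢lam d e R f)    = PS.t-lam R (P-strict-in d) (P-strict-in e) (P-strict-in f)
    P-strict-in (⊢app d e)        = PS.t-app (P-strict-in d) (P-strict-in e)
    P-strict-in (⊢conv d c e p)   =
      PS.t-conv tt (P-strict-in d) (λ _ → P-strict-in c) (P-strict-in e) (≡β⇒≃ p)

  mutual
    P-Wf-out : ∀ {Γ} → PS.Wf Γ → WF Γ
    P-Wf-out PS.wf-[]      = wf-nil
    P-Wf-out (PS.wf-∷ _ d) = wf-cons (P-strict-out d)

    P-strict-out : ∀ {Γ t A} → Γ PS.⊩ t ∶ A → Γ ⊢ t ∶ A
    P-strict-out (PS.t-con w (psig a)) = ⊢sort (P-Wf-out w) a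
    P-strict-out (PS.t-var w x)        = ⊢var (P-Wf-out w) x
    P-strict-out (PS.t-pi R d e)       = ⊢pi (P-strict-out d) (P-strict-out e) R
    P-strict-out (PS.t-lam R d e f)    = ⊢lam (P-strict-out d) (P-strict-out e) R (P-strict-out f)
    P-strict-out (PS.t-app d e)        = ⊢app (P-strict-out d) (P-strict-out e)
    P-strict-out (PS.t-conv _ d c e p) =
      ⊢conv (P-strict-out d) (P-strict-out (c tt)) (P-strict-out e) (≃⇒≡β p)

  P-in : ∀ {Γ t A} → Γ ⊢ t ∶ A → Γ Pr.⊩ t ∶ A
  P-in d = PStr.relax (P-strict-in d)

  P-out : ∀ {Γ t A} → Γ Pr.⊩ t ∶ A → Γ ⊢ t ∶ A
  P-out d = P-strict-out (PStr.strict d)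

  mutual
    L-Wf-in : ∀ {Γ} → LWF Γ → LS.Wf Γ
    L-Wf-in lwf-nil             = LS.wf-[]
    L-Wf-in (lwf-cons isType d) = LS.wf-∷ type (L-strict-in d)
    L-Wf-in (lwf-cons isKind d) = LS.wf-∷ kind (L-strict-in d)

    L-strict-in : ∀ {Γ t A} → Γ ⊢λ t ∶ A → Γ LS.⊩ t ∶ A
    L-strict-in (⊢Type w)              = LS.t-con (L-Wf-in w) lsig-Type
    L-strict-in (⊢const w s)           = LS.t-con (L-Wf-in w) (lsig s)
    L-strict-in (⊢var w x)             = LS.t-var (L-Wf-in w) x
    L-strict-in (⊢pi isType d e)       = LS.t-pi (lrule type) (L-strict-in d) (L-strict-in e)
    L-strict-in (⊢pi isKind d e)       = LS.t-pi (lrule kind) (L-strict-in d) (L-strict-in e)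
    L-strict-in (⊢lam isType d e f)    =
      LS.t-lam (lrule type) (L-strict-in d) (L-strict-in e) (L-strict-in f)
    L-strict-in (⊢lam isKind d e f)    =
      LS.t-lam (lrule kind) (L-strict-in d) (L-strict-in e) (L-strict-in f)
    L-strict-in (⊢app d e)             = LS.t-app (L-strict-in d) (L-strict-in e)
    L-strict-in (⊢conv isType d c e p) =
      LS.t-conv type (L-strict-in d) (λ _ → L-strict-in c) (L-strict-in e) (Equivalence.map (Step-map Rw⇒Root) p)
    L-strict-in (⊢conv isKind d c e p) =
      LS.t-conv kind (L-strict-in d) (λ _ → L-strict-in c) (L-strict-in e) (Equivalence.map (Step-map Rw⇒Root) p)

  LSort-out : ∀ {s} → LIsSort s → LSort (con s)
  LSort-out type = isType
  LSort-out kind = isKind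

  mutual
    L-Wf-out : ∀ {Γ} → LS.Wf Γ → LWF Γ
    L-Wf-out LS.wf-[]      = lwf-nil
    L-Wf-out (LS.wf-∷ i d) = lwf-cons (LSort-out i) (L-strict-out d)

    L-strict-out : ∀ {Γ t A} → Γ LS.⊩ t ∶ A → Γ ⊢λ t ∶ A
    L-strict-out (LS.t-con w lsig-Type)      = ⊢Type (L-Wf-out w)
    L-strict-out (LS.t-con w (lsig s))       = ⊢const (L-Wf-out w) s
    L-strict-out (LS.t-var w x)              = ⊢var (L-Wf-out w) x
    L-strict-out (LS.t-pi (lrule i) d e)     = ⊢pi (LSort-out i) (L-strict-out d) (L-strict-out e)
    L-strict-out (LS.t-lam (lrule i) d e f)  =
      ⊢lam (LSort-out i) (L-strict-out d) (L-strict-out e) (L-strict-out f)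
    L-strict-out (LS.t-app d e)              = ⊢app (L-strict-out d) (L-strict-out e)
    L-strict-out (LS.t-conv i d c e p)       =
      ⊢conv (LSort-out i) (L-strict-out d) (L-strict-out (c tt)) (L-strict-out e)
            (Equivalence.map (Step-map Root⇒Rw) p)

  L-in : ∀ {Γ t A} → Γ ⊢λ t ∶ A → Γ ⊩ t ∶ A
  L-in d = LStr.relax (L-strict-in d)

  L-out : ∀ {Γ t A} → Γ ⊩ t ∶ A → Γ ⊢λ t ∶ A
  L-out d = L-strict-out (LStr.strict d)

  -- Undecorated translation and its coherence

  El : Sort → LTerm → LTerm
  El s a = app (con (eps s)) a

  Prod : Sort → Sort → Sort → LTerm → LTerm → LTerm
  Prod s₁ s₂ s₃ a b = app (app (con (dotPi s₁ s₂ s₃)) a) (lam (El s₁ a) b)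

  ⊩Prod : ∀ {Γ s₁ s₂ s₃ a b} → Rl s₁ s₂ s₃ → Γ ⊩ a ∶ con (U s₁) → El s₁ a ∷ Γ ⊩ b ∶ con (U s₂) →
          Γ ⊩ Prod s₁ s₂ s₃ a b ∶ con (U s₃)
  ⊩Prod R a b =
    t-app (t-app (t-con (⊩⇒Wf a) (lsig (sig-dotPi R))) a) (t-lam (lrule type) (⊩eps a) (⊩U (⊩⇒Wf b)) b)

  El-Prod-≃ : ∀ {s₁ s₂ s₃ a b} → Rl s₁ s₂ s₃ → El s₃ (Prod s₁ s₂ s₃ a b) ≃ pi (El s₁ a) (El s₂ b)
  El-Prod-≃ R = ⟶⇒≃ (top (root-pi _ _ (lpi R))) ◅◅ ≃-pi ε (≃-app ε app-wk-lam-≃)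

  infix 4 _~_ _≈_ _≈Γ_

  -- The translation stripped of its typing premises: the sorts decorating the
  -- constants and annotations are arbitrary.  They are pinned down (see
  -- ~-coherent) as soon as the λΠ-term is well typed.
  data _~_ : LTerm → PTerm → Set where
    ~var  : ∀ {n} → var n ~ var n
    ~sort : ∀ {s₁ s₂} → con (dot s₁ s₂) ~ con s₁
    ~pi   : ∀ {a b A B s₁ s₂ s₃} → a ~ A → b ~ B → Prod s₁ s₂ s₃ a b ~ pi A B
    ~lam  : ∀ {a b A t s} → a ~ A → b ~ t → lam (El s a) b ~ lam A t
    ~app  : ∀ {a b t u} → a ~ t → b ~ u → app a b ~ app t u

  -- A typable sort has two kinds of image, `U s` and the decoding of a `dot` constant. `root-ax`
  -- makes them convertible, so both may be allowed.
  data _≈_ : LTerm → PTerm → Set where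
    ≈El : ∀ {s a A} → a ~ A → El s a ≈ A
    ≈U  : ∀ {s} → con (U s) ≈ con s

  data _≈Γ_ : LCtx → PCtx → Set where
    []  : [] ≈Γ []
    _∷_ : ∀ {T A Δ Γ} → T ≈ A → Δ ≈Γ Γ → (T ∷ Δ) ≈Γ (A ∷ Γ)

  ~-rename : ∀ ρ {a A} → a ~ A → rename ρ a ~ rename ρ A
  ~-rename ρ ~var       = ~var
  ~-rename ρ ~sort      = ~sort
  ~-rename ρ (~pi p q)  = ~pi (~-rename ρ p) (~-rename _ q)
  ~-rename ρ (~lam p q) = ~lam (~-rename ρ p) (~-rename _ q)
  ~-rename ρ (~app p q) = ~app (~-rename ρ p) (~-rename ρ q)

  ~-exts : ∀ {σ τ} → (∀ n → σ n ~ τ n) → ∀ n → exts σ n ~ exts τ n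
  ~-exts h zero    = ~var
  ~-exts h (suc n) = ~-rename suc (h n)

  ~-subst : ∀ {σ τ} → (∀ n → σ n ~ τ n) → ∀ {a A} → a ~ A → subst σ a ~ subst τ A
  ~-subst h ~var       = h _
  ~-subst h ~sort      = ~sort
  ~-subst h (~pi p q)  = ~pi (~-subst h p) (~-subst (~-exts h) q)
  ~-subst h (~lam p q) = ~lam (~-subst h p) (~-subst (~-exts h) q)
  ~-subst h (~app p q) = ~app (~-subst h p) (~-subst h q)

  ~-[] : ∀ {a A b B} → a ~ A → b ~ B → a [ b ] ~ A [ B ]
  ~-[] {b = b} {B} p q = ~-subst h p
    where
    h : ∀ n → sub0 b n ~ sub0 B n
    h zero    = q
    h (suc n) = ~var

  ≈-rename : ∀ ρ {T A} → T ≈ A → rename ρ T ≈ rename ρ A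
  ≈-rename ρ (≈El p) = ≈El (~-rename ρ p)
  ≈-rename ρ ≈U      = ≈U

  ≈Γ-lookup : ∀ {Δ Γ n A} → Δ ≈Γ Γ → Γ ∋ n ⦂ A → ∃ λ T → Δ ∋ n ⦂ T × T ≈ A
  ≈Γ-lookup (p ∷ _)  here      = _ , here , ≈-rename suc p
  ≈Γ-lookup (_ ∷ ps) (there x) with ≈Γ-lookup ps x
  ... | _ , y , q = _ , there y , ≈-rename suc q

  ≈Γ-lookupˡ : ∀ {Δ Γ n T} → Δ ≈Γ Γ → Δ ∋ n ⦂ T → ∃ λ A → Γ ∋ n ⦂ A × T ≈ A
  ≈Γ-lookupˡ (p ∷ _)  here      = _ , here , ≈-rename suc p
  ≈Γ-lookupˡ (_ ∷ ps) (there x) with ≈Γ-lookupˡ ps x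
  ... | _ , y , q = _ , there y , ≈-rename suc q

  -- Several steps may answer one, since the domain of a product is translated to two copies: the
  -- first argument of Π̇ and the annotation of the second.
  simulate : ∀ {a A A'} → a ~ A → A Pr.⟶₁ A' → ∃ λ a' → a ⟶* a' × a' ~ A'
  simulate (~app (~lam _ b) c) (top (Pr.root-β (β _ _ _))) = _ , top (root-β (β _ _ _)) ◅ ε , ~-[] b c
  simulate (~pi a b) (piL s) with simulate a s
  ... | _ , r , a' = _ , ⟶*-app (⟶*-app ε r) (⟶*-lam (⟶*-app ε r) ε) , ~pi a' b
  simulate (~pi a b) (piR s) with simulate b s
  ... | _ , r , b' = _ , ⟶*-app ε (⟶*-lam ε r) , ~pi a b'
  simulate (~lam a b) (lamL s) with simulate a s
  ... | _ , r , a' = _ , ⟶*-lam (⟶*-app ε r) ε , ~lam a' b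
  simulate (~lam a b) (lamR s) with simulate b s
  ... | _ , r , b' = _ , ⟶*-lam ε r , ~lam a b'
  simulate (~app a b) (appL s) with simulate a s
  ... | _ , r , a' = _ , ⟶*-app r ε , ~app a' b
  simulate (~app a b) (appR s) with simulate b s
  ... | _ , r , b' = _ , ⟶*-app ε r , ~app a b'

  simulate* : ∀ {a A A'} → a ~ A → A Pr.⟶* A' → ∃ λ a' → a ⟶* a' × a' ~ A'
  simulate* p ε = _ , ε , p
  simulate* p (s ◅ ss) with simulate p s
  ... | _ , r , q with simulate* q ss
  ...   | _ , r' , q' = _ , r ◅◅ r' , q'

  code-functional : ∀ {Γ a b s s'} → a ≃ b → Γ ⊩ a ∶ con (U s) → Γ ⊩ b ∶ con (U s') → s ≡ s'
  code-functional p d e with ≃-con-injective (⊩-functional-≃ p d e)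
  ... | refl = refl

  -- Domains are compared first: once convertible, they have the same type `U s`, which identifies
  -- their sorts and puts both bodies in one context. The bodies then fix the second sort, and
  -- functionality of the rules fixes the third.
  ~-coherent : ∀ {Γ a b A T T'} → a ~ A → b ~ A → Γ ⊩ a ∶ T → Γ ⊩ b ∶ T' → a ≃ b
  ~-coherent ~var ~var _ _ = ε
  ~-coherent ~sort ~sort d e =
    ≡⇒≃ (cong (λ s → con (dot _ s)) (proj₁ functional (proj₁ (inv-dot d)) (proj₁ (inv-dot e))))
  ~-coherent (~pi p q) (~pi p' q') d e with inv-dotPi-lam d | inv-dotPi-lam e
  ... | R , a , _ , b , _ | R' , a' , _ , b' , _ with ~-coherent p p' a a'
  ...   | r with code-functional r a a'
  ...     | refl with ⊩-ctx-conv type (≃-app ε r) (⊩eps a) b'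
  ...       | b″ with ~-coherent q q' b b″
  ...         | r' with code-functional r' b b″
  ...           | refl with proj₂ functional R R'
  ...             | refl = ≃-app (≃-app ε r) (≃-lam (≃-app ε r) r')
  ~-coherent (~lam p q) (~lam p' q') d e with inv-lam d | inv-lam e
  ... | _ , _ , _ , _ , lrule _ , a , _ , b , _ | _ , _ , _ , _ , lrule _ , a' , _ , b' , _
      with inv-eps a | inv-eps a'
  ...   | c , _ | c' , _ with ~-coherent p p' c c'
  ...     | r with code-functional r c c'
  ...       | refl = ≃-lam (≃-app ε r) (~-coherent q q' b (⊩-ctx-conv type (≃-app ε r) a b'))
  ~-coherent (~app p q) (~app p' q') d e with inv-app d | inv-app e
  ... | _ , _ , a , b , _ | _ , _ , a' , b' , _ = ≃-app (~-coherent p p' a a') (~-coherent q q' b b')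

  ~-coherent-≃ : ∀ {Γ a b A B T T'} → a ~ A → b ~ B → A Pr.≃ B → Γ ⊩ a ∶ T → Γ ⊩ b ∶ T' → a ≃ b
  ~-coherent-≃ p q r d e with Pr.church-rosser r
  ... | _ , r₁ , r₂ with simulate* p r₁ | simulate* q r₂
  ...   | _ , s₁ , p' | _ , s₂ , q' =
    ⟶*⇒≃ s₁ ◅◅ ~-coherent p' q' (subject-reduction* d s₁) (subject-reduction* e s₂) ◅◅ ≃-sym (⟶*⇒≃ s₂)

  -- Replaying the reduction of `A` to `s'` turns `a` into some `dot s' s₂`. Its type `U s` forces
  -- `s₂` to be `s`, which is what `root-ax` requires.
  El-sort-≃ : ∀ {Γ a A s s' T} → a ~ A → A Pr.≃ con s' → Γ ⊩ El s a ∶ T → El s a ≃ con (U s')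
  El-sort-≃ p r d with inv-eps d | simulate* p (Pr.≃-con⇒⟶* r)
  ... | a , _ | _ , rs , ~sort with inv-dot (subject-reduction* a rs)
  ...   | ax , q with ≃-con-injective q
  ...     | refl = ≃-app ε (⟶*⇒≃ rs) ◅◅ ⟶⇒≃ (top (root-ax (lax ax)))

  ≈-coherent : ∀ {Γ T T' A A' S S'} → T ≈ A → T' ≈ A' → A Pr.≃ A' → Γ ⊩ T ∶ S → Γ ⊩ T' ∶ S' → T ≃ T'
  ≈-coherent (≈El p) (≈El q) r d e with inv-eps d | inv-eps e
  ... | a , _ | b , _ with ~-coherent-≃ p q r a b
  ...   | c with code-functional c a b
  ...     | refl = ≃-app ε c
  ≈-coherent (≈El p) ≈U r d e = El-sort-≃ p r d
  ≈-coherent ≈U (≈El q) r d e = ≃-sym (El-sort-≃ q (Pr.≃-sym r) e)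
  ≈-coherent ≈U ≈U r d e = ≡⇒≃ (cong (λ s → con (U s)) (Pr.≃-con-injective r))

  ≈⇒Type : ∀ {Γ T A S} → T ≈ A → Γ ⊩ T ∶ S → Γ ⊩ T ∶ con Type
  ≈⇒Type (≈El _) d = ⊩eps (proj₁ (inv-eps d))
  ≈⇒Type ≈U      d = ⊩U (⊩⇒Wf d)

  ⊩-code : ∀ {Γ a T s} → T ≈ con s → Γ ⊩ T ∶ con Type → Γ ⊩ a ∶ T → Γ ⊩ a ∶ con (U s)
  ⊩-code p d e = conv type e (⊩U (⊩⇒Wf e)) (≈-coherent p ≈U ε d (⊩U (⊩⇒Wf e)))

  ≈-pi : ∀ {Γ T A B} → T ≈ pi A B → Γ ⊩ T ∶ con Type →
         ∃ λ s₁ → ∃ λ s₂ → ∃ λ a → ∃ λ b → a ~ A × b ~ B ×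
         Γ ⊩ a ∶ con (U s₁) × El s₁ a ∷ Γ ⊩ b ∶ con (U s₂) × T ≃ pi (El s₁ a) (El s₂ b)
  ≈-pi (≈El (~pi p q)) d with inv-eps d
  ... | c , _ with inv-dotPi-lam c
  ...   | R , a , _ , b , r with ≃-con-injective r
  ...     | refl = _ , _ , _ , _ , p , q , a , b , El-Prod-≃ R

  pi-El-Type : ∀ {Γ s₁ s₂ a b} → Γ ⊩ a ∶ con (U s₁) → El s₁ a ∷ Γ ⊩ b ∶ con (U s₂) →
               Γ ⊩ pi (El s₁ a) (El s₂ b) ∶ con Type
  pi-El-Type a b = t-pi (lrule type) (⊩eps a) (⊩eps b)

  -- Soundness of the translation

  Translated : LCtx → PTerm → PTerm → Set
  Translated Δ t A = ∃ λ t' → ∃ λ T → t' ~ t × T ≈ A × Δ ⊩ T ∶ con Type × Δ ⊩ t' ∶ T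

  code : ∀ {Δ A s} → Translated Δ A (con s) → ∃ λ a → a ~ A × Δ ⊩ a ∶ con (U s)
  code (_ , _ , p , q , d , e) = _ , p , ⊩-code q d e

  app-sound : ∀ {Δ t u t' u' A B T T'} → t' ~ t → u' ~ u → T ≈ pi A B → T' ≈ A →
              Δ ⊩ T ∶ con Type → Δ ⊩ T' ∶ con Type → Δ ⊩ t' ∶ T → Δ ⊩ u' ∶ T' →
              ∃ λ S → S ≈ (B [ u ]) × Δ ⊩ S ∶ con Type × Δ ⊩ app t' u' ∶ S
  app-sound p q r r' dT dT' d e with ≈-pi r dT
  ... | _ , _ , _ , _ , pa , pb , a , b , s with conv type e (⊩eps a) (≈-coherent r' (≈El pa) ε dT' (⊩eps a))
  ...   | e' = _ , ≈El (~-[] pb q) , ⊩-[] (⊩eps b) e' , t-app (conv type d (pi-El-Type a b) s) e'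

  sound : ∀ {Γ Δ t A} → Γ Pr.⊩ t ∶ A → Δ ≈Γ Γ → Wf Δ → Translated Δ t A
  sound (Pr.t-con _ (psig a)) g w = _ , _ , ~sort , ≈U , ⊩U w , t-con w (lsig (sig-dot a))
  sound (Pr.t-var _ x) g w with ≈Γ-lookup g x
  ... | _ , y , p with ∋-valid w y
  ...   | _ , _ , d = _ , _ , ~var , p , ≈⇒Type p d , t-var w y
  sound (Pr.t-pi R d e) g w with code (sound d g w)
  ... | _ , p , a with code (sound e (≈El p ∷ g) (wf-∷ type (⊩eps a)))
  ...   | _ , q , b = _ , _ , ~pi p q , ≈U , ⊩U w , ⊩Prod R a b
  sound (Pr.t-lam R d e f) g w with code (sound d g w)
  ... | _ , p , a with wf-∷ type (⊩eps a)
  ...   | w' with code (sound e (≈El p ∷ g) w') | sound f (≈El p ∷ g) w'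
  -- `B` is translated twice, from its own derivation and as the type of `t`; coherence reconciles
  -- the two images.
  ...     | _ , q , b | _ , _ , r , r' , dT , t =
    _ , _ , ~lam p r , ≈El (~pi p q) , ⊩eps (⊩Prod R a b) ,
    conv type
      (t-lam (lrule type) (⊩eps a) (⊩eps b) (conv type t (⊩eps b) (≈-coherent r' (≈El q) ε dT (⊩eps b))))
      (⊩eps (⊩Prod R a b)) (≃-sym (El-Prod-≃ R))
  sound (Pr.t-app d e) g w with sound d g w | sound e g w
  ... | _ , _ , p , r , dT , t | _ , _ , q , r' , dT' , u with app-sound p q r r' dT dT' t u
  ...   | _ , s , dS , d' = _ , _ , ~app p q , s , dS , d'
  sound (Pr.t-conv _ d _ e p) g w with sound d g w | code (sound e g w)
  ... | _ , _ , q , r , dT , t | _ , q' , b =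
    _ , _ , q , ≈El q' , ⊩eps b , conv type t (⊩eps b) (≈-coherent r (≈El q') p dT (⊩eps b))

  Tr⇒~ : ∀ {Γ t a} → Tr Γ t a → a ~ t
  Tr⇒~ tr-var             = ~var
  Tr⇒~ (tr-sort _)        = ~sort
  Tr⇒~ (tr-pi _ _ _ p q)  = ~pi (Tr⇒~ p) (Tr⇒~ q)
  Tr⇒~ (tr-lam _ p q)     = ~lam (Tr⇒~ p) (Tr⇒~ q)
  Tr⇒~ (tr-app p q)       = ~app (Tr⇒~ p) (Tr⇒~ q)

  TypedAs : LCtx → LTerm → PTerm → Set
  TypedAs Δ a A = ∃ λ T → T ≈ A × Δ ⊩ T ∶ con Type × Δ ⊩ a ∶ T

  -- `sound` supplies one translation of `t` whose type translates `A`. By coherence `a` is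
  -- convertible to it, so uniqueness of types carries that type over to `a`.
  retype : ∀ {Γ Δ t A a T} → Γ Pr.⊩ t ∶ A → Δ ≈Γ Γ → a ~ t → Δ ⊩ a ∶ T → TypedAs Δ a A
  retype d g p e with sound d g (⊩⇒Wf e)
  ... | _ , _ , q , r , dT , f =
    _ , r , dT , conv type e dT (⊩-functional-≃ (~-coherent p q e f) e f)

  -- `sound` only produces some translation, whereas the theorem speaks of a given one. Each case
  -- types the given term somehow, then `retype` gives the type its intended form.
  Tr-typed : ∀ {Γ Δ t a A} → Tr Γ t a → Γ Pr.⊩ t ∶ A → Δ ≈Γ Γ → Wf Δ → TypedAs Δ a A
  Tr-code : ∀ {Γ Δ A a s} → Tr Γ A a → Γ ⊢ A ∶ con s → Δ ≈Γ Γ → Wf Δ → Δ ⊩ a ∶ con (U s)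

  Tr-code p d g w with Tr-typed p (P-in d) g w
  ... | _ , r , dT , e = ⊩-code r dT e

  Tr-typed tr-var d g w with Pr.inv-var d
  ... | _ , x , _ with ≈Γ-lookup g x
  ...   | _ , y , _ = retype d g ~var (t-var w y)
  Tr-typed (tr-sort a) d g w = retype d g ~sort (t-con w (lsig (sig-dot a)))
  Tr-typed t@(tr-pi dA dB dPi p q) d g w with Tr-code p dA g w
  ... | a with Tr-code q dB (≈El (Tr⇒~ p) ∷ g) (wf-∷ type (⊩eps a)) | Pr.inv-pi (P-in dPi)
  ...   | b | _ , _ , _ , R , A , B , r
        -- Uniqueness of types in P shows that the sorts recorded by `tr-pi` form an actual rule.
        with Pr.≃-con-injective (Pr.⊩-functional _ A (P-in dA))
           | Pr.≃-con-injective (Pr.⊩-functional _ B (P-in dB))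
           | Pr.≃-con-injective r
  ...     | refl | refl | refl = retype d g (Tr⇒~ t) (⊩Prod R a b)
  Tr-typed t@(tr-lam dA p q) d g w with Tr-code p dA g w | Pr.inv-lam d
  ... | a | _ , _ , _ , _ , _ , _ , _ , b , _
        with Tr-typed q b (≈El (Tr⇒~ p) ∷ g) (wf-∷ type (⊩eps a))
  ...   | _ , _ , dT , e = retype d g (Tr⇒~ t) (t-lam (lrule type) (⊩eps a) dT e)
  Tr-typed t@(tr-app p q) d g w with Pr.inv-app d
  ... | _ , _ , e , f , _ with Tr-typed p e g w | Tr-typed q f g w
  ...   | _ , r , dT , e' | _ , r' , dT' , f' with app-sound (Tr⇒~ p) (Tr⇒~ q) r r' dT dT' e' f'
  ...     | _ , _ , _ , d' = retype d g (Tr⇒~ t) d'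

  -- η-expansion of Π̇.  The congruence does not contain η, but a normal term may
  -- contain Π̇ partially applied or applied to a variable, which is not of the
  -- form |u|.
  expand : LConst Sort → LTerm
  expand (dotPi s₁ s₂ s₃) =
    lam (con (U s₁)) (lam (pi (El s₁ (var 0)) (con (U s₂))) (Prod s₁ s₂ s₃ (var 1) (app (var 1) (var 0))))
  expand c = con c

  expand-closed : ∀ c σ → subst σ (expand c) ≡ expand c
  expand-closed Type            σ = refl
  expand-closed Kind            σ = refl
  expand-closed (U _)           σ = refl
  expand-closed (eps _)         σ = refl
  expand-closed (dot _ _)       σ = refl
  expand-closed (dotPi _ _ _)   σ = refl

  private
    module E = ConstantSubstitution expand expand-closed
    module EC = E.Conversion LRules LRules
  open E using () renaming (csub to η)

  expand-≃ : ∀ {s₁ s₂ s₃} X Y →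
    app (app (expand (dotPi s₁ s₂ s₃)) X) Y ≃ Prod s₁ s₂ s₃ X (app (rename suc Y) (var zero))
  expand-≃ {s₁} {s₂} {s₃} X Y =
    ≃-app (⟶⇒≃ (top (root-β (β _ _ _)))) ε ◅◅ ⟶⇒≃ (top (root-β (β _ _ _))) ◅◅
    ≡⇒≃ (cong (λ Z → Prod s₁ s₂ s₃ Z (app (rename suc Y) (var zero))) (wk-[] X Y))

  -- In the product case the contractum already applies `Y` to a fresh variable, so the η-expansion
  -- of `Y` disappears by one β step after decoding.
  η-Root : ∀ {t u} → Root t u → η t ≃ η u
  η-Root (root-β b)            = EC.csub-β b
  η-Root (root-ax (lax a))     = ⟶⇒≃ (top (root-ax (lax a)))
  η-Root (root-pi X Y (lpi R)) =
    ≃-app ε (expand-≃ (η X) (η Y)) ◅◅ El-Prod-≃ R ◅◅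
    ≃-pi ε (≃-app ε (≃-app (≡⇒≃ (sym (E.csub-rename suc Y))) ε))

  η-≃ : ∀ {t u} → t ≃ u → η t ≃ η u
  η-≃ = EC.csub-≃ η-Root

  η-sort : ∀ {s} → LIsSort s → expand s ≡ con s
  η-sort type = refl
  η-sort kind = refl

  η-SigType : ∀ {c T} → SigType c T → η T ≡ T
  η-SigType (sig-U _)     = refl
  η-SigType (sig-eps _)   = refl
  η-SigType (sig-dot _)   = refl
  η-SigType (sig-dotPi _) = refl

  ⊩expand : ∀ {Γ c T} → Wf Γ → SigType c T → Γ ⊩ expand c ∶ T
  ⊩expand w (sig-U s)   = t-con w (lsig (sig-U s))
  ⊩expand w (sig-eps s) = t-con w (lsig (sig-eps s))
  ⊩expand w (sig-dot a) = t-con w (lsig (sig-dot a))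
  ⊩expand {Γ} w (sig-dotPi {s₁} {s₂} {s₃} R) =
    t-lam (lrule type) (⊩U w) (t-pi (lrule type) arr (⊩U w₂))
      (t-lam (lrule type) arr (⊩U w₂) (⊩Prod R (x w₂) body))
    where
    arrow : ℕ → LTerm
    arrow n = pi (El s₁ (var n)) (con (U s₂))
    w₁ : Wf (con (U s₁) ∷ Γ)
    w₁ = wf-∷ type (⊩U w)
    arr : con (U s₁) ∷ Γ ⊩ arrow 0 ∶ con Type
    arr = t-pi (lrule type) (⊩eps (t-var w₁ here)) (⊩U (wf-∷ type (⊩eps (t-var w₁ here))))
    w₂ : Wf (arrow 0 ∷ con (U s₁) ∷ Γ)
    w₂ = wf-∷ type arr
    x : Wf (arrow 0 ∷ con (U s₁) ∷ Γ) → arrow 0 ∷ con (U s₁) ∷ Γ ⊩ var 1 ∶ con (U s₁)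
    x w = t-var w (there here)
    w₃ : Wf (El s₁ (var 1) ∷ arrow 0 ∷ con (U s₁) ∷ Γ)
    w₃ = wf-∷ type (⊩eps (x w₂))
    body : El s₁ (var 1) ∷ arrow 0 ∷ con (U s₁) ∷ Γ ⊩ app (var 1) (var 0) ∶ con (U s₂)
    body = t-app (t-var w₃ (there here)) (t-var w₃ here)

  η-∋ : ∀ {Γ n A} → Γ ∋ n ⦂ A → map η Γ ∋ n ⦂ η A
  η-∋ (here {A = A})      = transport (_∋_⦂_ _ _) (sym (E.csub-rename suc A)) here
  η-∋ (there {A = A} x)   = transport (_∋_⦂_ _ _) (sym (E.csub-rename suc A)) (there (η-∋ x))

  mutual
    η-Wf : ∀ {Γ} → Wf Γ → Wf (map η Γ)
    η-Wf wf-[]      = wf-[]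
    η-Wf (wf-∷ i d) = wf-∷ i (⊩-≡ (⊩η d) (η-sort i))

    ⊩η : ∀ {Γ t A} → Γ ⊩ t ∶ A → map η Γ ⊩ η t ∶ η A
    ⊩η (t-con w lsig-Type) = t-con (η-Wf w) lsig-Type
    ⊩η (t-con w (lsig s))  = ⊩-≡ (⊩expand (η-Wf w) s) (sym (η-SigType s))
    ⊩η (t-var w x)         = t-var (η-Wf w) (η-∋ x)
    ⊩η (t-pi (lrule i) d e) =
      ⊩-≡ (t-pi (lrule i) (⊩η d) (⊩-≡ (⊩η e) (η-sort i))) (sym (η-sort i))
    ⊩η (t-lam (lrule i) d e f) = t-lam (lrule i) (⊩η d) (⊩-≡ (⊩η e) (η-sort i)) (⊩η f)
    ⊩η (t-app {u = u} {B = B} d e) = ⊩-≡ (t-app (⊩η d) (⊩η e)) (sym (E.csub-[] B u))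
    ⊩η (t-conv i d _ e p) = conv i (⊩η d) (⊩-≡ (⊩η e) (η-sort i)) (η-≃ p)

  -- A translated Π̇ already has an abstraction as second argument, so everything introduced by the
  -- expansion β-reduces away.
  ~-η : ∀ {a A} → a ~ A → η a ≃ a
  ~-η ~var       = ε
  ~-η ~sort      = ε
  ~-η (~pi p q)  =
    expand-≃ _ _ ◅◅ ≃-app (≃-app ε (~-η p)) (≃-lam (≃-app ε (~-η p)) (app-wk-lam-≃ ◅◅ ~-η q))
  ~-η (~lam p q) = ≃-lam (≃-app ε (~-η p)) (~-η q)
  ~-η (~app p q) = ≃-app (~-η p) (~-η q)

  ≈-η : ∀ {T A} → T ≈ A → η T ≃ T
  ≈-η (≈El p) = ≃-app ε (~-η p)
  ≈-η ≈U      = ε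

  -- The back-translation.  The images of Type and Kind are irrelevant, but there
  -- must be some closed term to send them to, hence the parameter.
  erase-con : Sort → LConst Sort → PTerm
  erase-con s₀ Type            = con s₀
  erase-con s₀ Kind            = con s₀
  erase-con s₀ (U s)           = con s
  erase-con s₀ (eps s)         = lam (con s) (var 0)
  erase-con s₀ (dot s _)       = con s
  erase-con s₀ (dotPi s₁ s₂ _) =
    lam (con s₁) (lam (pi (var 0) (con s₂)) (pi (var 1) (app (var 1) (var 0))))

  erase-con-closed : ∀ s₀ c σ → subst σ (erase-con s₀ c) ≡ erase-con s₀ c
  erase-con-closed s₀ Type            σ = refl
  erase-con-closed s₀ Kind            σ = refl
  erase-con-closed s₀ (U _)           σ = refl
  erase-con-closed s₀ (eps _)         σ = refl
  erase-con-closed s₀ (dot _ _)       σ = refl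
  erase-con-closed s₀ (dotPi _ _ _)   σ = refl

  private
    module Er (s₀ : Sort) = ConstantSubstitution (erase-con s₀) (erase-con-closed s₀)
    module ErC (s₀ : Sort) = Er.Conversion s₀ LRules βRules
  open Er using () renaming (csub to erase)

  erase-El : ∀ s₀ {s} X → erase s₀ (El s X) Pr.≃ erase s₀ X
  erase-El s₀ X = Pr.⟶⇒≃ (top (Pr.root-β (β _ _ _)))

  erase-dotPi : ∀ s₀ {s₁ s₂ s₃} X Y →
                app (app (erase-con s₀ (dotPi s₁ s₂ s₃)) X) Y Pr.≃ pi X (app (rename suc Y) (var zero))
  erase-dotPi s₀ X Y =
    Pr.≃-app (Pr.⟶⇒≃ (top (Pr.root-β (β _ _ _)))) ε ◅◅ Pr.⟶⇒≃ (top (Pr.root-β (β _ _ _))) ◅◅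
    Pr.≡⇒≃ (cong (λ Z → pi Z (app (rename suc Y) (var zero))) (wk-[] X Y))

  erase-Root : ∀ s₀ {t u} → Root t u → erase s₀ t Pr.≃ erase s₀ u
  erase-Root s₀ (root-β b)            = ErC.csub-β s₀ b
  erase-Root s₀ (root-ax (lax {s₁} {s₂} _)) = erase-El s₀ (con (dot s₁ s₂))
  erase-Root s₀ (root-pi X Y (lpi {s₁} {s₂} {s₃} _)) =
    erase-El s₀ (app (app (con (dotPi s₁ s₂ s₃)) X) Y) ◅◅
    erase-dotPi s₀ {s₃ = s₃} (erase s₀ X) (erase s₀ Y) ◅◅
    Pr.≃-pi (Pr.≃-sym (erase-El s₀ X))
      (Pr.≃-sym (erase-El s₀ (app (rename suc Y) (var zero)) ◅◅
                 Pr.≃-app (Pr.≡⇒≃ (Er.csub-rename s₀ suc Y)) ε))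

  -- Typing plays no part here: an erased term may be ill-typed in P, and later uses rely on
  -- confluence of β over raw terms only.
  erase-≃ : ∀ s₀ {t u} → t ≃ u → erase s₀ t Pr.≃ erase s₀ u
  erase-≃ s₀ = ErC.csub-≃ s₀ (erase-Root s₀)

  ~-erase : ∀ s₀ {a A} → a ~ A → erase s₀ a Pr.≃ A
  ~-erase s₀ ~var       = ε
  ~-erase s₀ ~sort      = ε
  ~-erase s₀ (~pi {s₃ = s₃} p q) =
    erase-dotPi s₀ {s₃ = s₃} _ _ ◅◅ Pr.≃-pi (~-erase s₀ p) (Pr.app-wk-lam-≃ ◅◅ ~-erase s₀ q)
  ~-erase s₀ (~lam {a = a} p q) = Pr.≃-lam (erase-El s₀ a ◅◅ ~-erase s₀ p) (~-erase s₀ q)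
  ~-erase s₀ (~app p q) = Pr.≃-app (~-erase s₀ p) (~-erase s₀ q)

  ≈-erase : ∀ s₀ {T A} → T ≈ A → erase s₀ T Pr.≃ A
  ≈-erase s₀ (≈El {a = a} p) = erase-El s₀ a ◅◅ ~-erase s₀ p
  ≈-erase s₀ ≈U              = ε

  -- Provides the default sort for `erase`. The set of sorts of P might be empty, so one is taken
  -- from the type at hand.
  ≈-some-sort : ∀ {T A} → T ≈ A → Sort
  ≈-some-sort (≈El {s} _) = s
  ≈-some-sort (≈U {s})    = s

  ≈-reflects-≃ : ∀ {T T' A A'} → T ≈ A → T' ≈ A' → T ≃ T' → A Pr.≃ A'
  ≈-reflects-≃ p q r = Pr.≃-sym (≈-erase s₀ p) ◅◅ erase-≃ s₀ r ◅◅ ≈-erase s₀ q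
    where s₀ = ≈-some-sort p

  -- Weak η-long β-normal forms

  Plain : LConst Sort → Set
  Plain (dotPi _ _ _) = ⊥
  Plain _             = ⊤

  -- Weak η-long terms; annotations and products are left unconstrained.
  data Long : LTerm → Set where
    long-var   : ∀ {n} → Long (var n)
    long-con   : ∀ {c} → Plain c → Long (con c)
    long-pi    : ∀ {A B} → Long (pi A B)
    long-lam   : ∀ {A t} → Long t → Long (lam A t)
    long-app   : ∀ {t u} → Long t → Long u → Long (app t u)
    long-dotPi : ∀ {s₁ s₂ s₃ a c b} → Long a → Long b →
                 Long (app (app (con (dotPi s₁ s₂ s₃)) a) (lam c b))

  Long-rename : ∀ ρ {t} → Long t → Long (rename ρ t)
  Long-rename ρ long-var         = long-var
  Long-rename ρ (long-con p)     = long-con p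
  Long-rename ρ long-pi          = long-pi
  Long-rename ρ (long-lam l)     = long-lam (Long-rename _ l)
  Long-rename ρ (long-app l m)   = long-app (Long-rename ρ l) (Long-rename ρ m)
  Long-rename ρ (long-dotPi l m) = long-dotPi (Long-rename ρ l) (Long-rename _ m)

  Long-exts : ∀ {σ} → (∀ n → Long (σ n)) → ∀ n → Long (exts σ n)
  Long-exts h zero    = long-var
  Long-exts h (suc n) = Long-rename suc (h n)

  Long-subst : ∀ {σ} → (∀ n → Long (σ n)) → ∀ {t} → Long t → Long (subst σ t)
  Long-subst h long-var         = h _
  Long-subst h (long-con p)     = long-con p
  Long-subst h long-pi          = long-pi
  Long-subst h (long-lam l)     = long-lam (Long-subst (Long-exts h) l)
  Long-subst h (long-app l m)   = long-app (Long-subst h l) (Long-subst h m)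
  Long-subst h (long-dotPi l m) = long-dotPi (Long-subst h l) (Long-subst (Long-exts h) m)

  Long-[] : ∀ {t u} → Long t → Long u → Long (t [ u ])
  Long-[] {u = u} l m = Long-subst h l
    where
    h : ∀ n → Long (sub0 u n)
    h zero    = m
    h (suc n) = long-var

  Long-η : ∀ t → Long (η t)
  Long-η (var n)             = long-var
  Long-η (con Type)          = long-con tt
  Long-η (con Kind)          = long-con tt
  Long-η (con (U _))         = long-con tt
  Long-η (con (eps _))       = long-con tt
  Long-η (con (dot _ _))     = long-con tt
  Long-η (con (dotPi _ _ _)) = long-lam (long-lam (long-dotPi long-var (long-app long-var long-var)))
  Long-η (pi A B)            = long-pi
  Long-η (lam A t)           = long-lam (Long-η t)
  Long-η (app t u)           = long-app (Long-η t) (Long-η u)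

  -- Rewrite redexes, and any redex in an annotation or a product, may remain: annotations matter
  -- only up to conversion, and a product is never an object.
  mutual
    data Nf : LTerm → Set where
      nf-lam : ∀ {A t} → Nf t → Nf (lam A t)
      nf-ne  : ∀ {t} → Ne t → Nf t

    data Ne : LTerm → Set where
      ne-var   : ∀ {n} → Ne (var n)
      ne-con   : ∀ {c} → Plain c → Ne (con c)
      ne-pi    : ∀ {A B} → Ne (pi A B)
      ne-app   : ∀ {t u} → Ne t → Nf u → Ne (app t u)
      ne-dotPi : ∀ {s₁ s₂ s₃ a c b} → Nf a → Nf b → Ne (app (app (con (dotPi s₁ s₂ s₃)) a) (lam c b))

  -- β preserves longness because substitution leaves the abstraction under Π̇ an abstraction. A
  -- normal long term in function position is either an abstraction, which gives a redex, or
  -- neutral.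
  progress : ∀ {t} → Long t → Nf t ⊎ (∃ λ u → Step Beta t u × Long u)
  progress long-var     = inj₁ (nf-ne ne-var)
  progress (long-con p) = inj₁ (nf-ne (ne-con p))
  progress long-pi      = inj₁ (nf-ne ne-pi)
  progress (long-lam l) with progress l
  ... | inj₁ n           = inj₁ (nf-lam n)
  ... | inj₂ (_ , s , m) = inj₂ (_ , lamR s , long-lam m)
  progress (long-app l m) with progress l
  ... | inj₂ (_ , s , l') = inj₂ (_ , appL s , long-app l' m)
  progress (long-app (long-lam l) m) | inj₁ (nf-lam _) = inj₂ (_ , top (β _ _ _) , Long-[] l m)
  progress (long-app l m) | inj₁ (nf-ne n) with progress m
  ... | inj₁ n'           = inj₁ (nf-ne (ne-app n n'))
  ... | inj₂ (_ , s , m') = inj₂ (_ , appR s , long-app l m')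
  progress (long-dotPi l m) with progress l | progress m
  ... | inj₂ (_ , s , l') | _                 = inj₂ (_ , appL (appR s) , long-dotPi l' m)
  ... | inj₁ n            | inj₂ (_ , s , m') = inj₂ (_ , appR (lamR s) , long-dotPi l m')
  ... | inj₁ n            | inj₁ n'           = inj₁ (nf-ne (ne-dotPi n n'))

  normalise : ∀ {Γ t T} → Γ ⊩ t ∶ T → Long t → SN t → ∃ λ u → Nf u × Γ ⊩ u ∶ T
  normalise d l (acc rs) with progress l
  ... | inj₁ n = _ , n , d
  ... | inj₂ (_ , s , m) = normalise (subject-reduction d (Step-map root-β s)) m (rs (Step-map rw-β s))

  -- Reconstruction of a term of P from a normal form

  ≈-≃-pi : ∀ {Γ Δ T A C D} → T ≈ A → Δ ⊩ T ∶ con Type → Pr.Valid Γ A → T ≃ pi C D →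
    ∃ λ s₁ → ∃ λ s₂ → ∃ λ a → ∃ λ b → ∃ λ A₁ → ∃ λ B₁ → ∃ λ s →
    A Pr.≃ pi A₁ B₁ × Γ Pr.⊩ pi A₁ B₁ ∶ con s × a ~ A₁ × b ~ B₁ ×
    Δ ⊩ a ∶ con (U s₁) × El s₁ a ∷ Δ ⊩ b ∶ con (U s₂) × T ≃ pi (El s₁ a) (El s₂ b)
  ≈-≃-pi ≈U d v p = ⊥-elim (con≄pi p)
  -- The decoration `s` serves as the default sort of the erasure.
  ≈-≃-pi (≈El {s} q) d v p with Pr.≃-pi⇒⟶* (Pr.≃-sym (≈-erase s (≈El {s} q)) ◅◅ erase-≃ s p)
  ≈-≃-pi (≈El q) d (inj₁ (_ , _ , refl)) p | _ , _ , r with Pr.con-⟶* r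
  ... | ()
  ≈-≃-pi (≈El q) d (inj₂ (_ , _ , e)) p | _ , _ , r with simulate* q r
  -- The reduction of `A` to a product, found on raw terms, is replayed on its code, where inversion
  -- gives codes for the domain and the codomain.
  ... | _ , r' , q' with ≈-pi (≈El q') (⊩eps (subject-reduction* (proj₁ (inv-eps d)) r'))
  ...   | _ , _ , _ , _ , pa , pb , a , b , eq =
    _ , _ , _ , _ , _ , _ , _ , Pr.⟶*⇒≃ r , PSR.subject-reduction* e r , pa , pb , a , b ,
    ≃-app ε (⟶*⇒≃ r') ◅◅ eq

  -- The link between `t` and `t₀` is recorded because `t` may occur in the types of later terms,
  -- where `t₀` has to replace it.
  Checked : LCtx → PCtx → LTerm → LTerm → PTerm → Set
  Checked Δ Γ t T A = ∃ λ u → ∃ λ t₀ → Γ Pr.⊩ u ∶ A × t₀ ~ u × t ≃ t₀ × Δ ⊩ t₀ ∶ T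

  Synthesised : LCtx → PCtx → LTerm → LTerm → Set
  Synthesised Δ Γ t T = ∃ λ A → ∃ λ T₀ → T ≃ T₀ × T₀ ≈ A × Δ ⊩ T₀ ∶ con Type × Checked Δ Γ t T₀ A

  -- The types of the terms that are not objects, such as U_s and ε_s.
  Large : LCtx → LTerm → Set
  Large Δ T = (T ≃ con Kind) ⊎ (∃ λ T' → T ≃ T' × Δ ⊩ T' ∶ con Kind)

  Large⇒¬Type : ∀ {Δ T T'} → Large Δ T → T ≃ T' → ¬ (Δ ⊩ T' ∶ con Type)
  Large⇒¬Type (inj₁ p) q d with inv-con (subject-reduction* d (≃-con⇒⟶* (≃-sym q ◅◅ p)))
  ... | _ , lsig () , _
  Large⇒¬Type (inj₂ (_ , p , e)) q d with ≃-con-injective (⊩-functional-≃ (≃-sym p ◅◅ q) e d)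
  ... | ()

  Large-sort : ∀ {Δ s T} → Wf Δ → LIsSort s → con s ≃ T → Large Δ T
  Large-sort w type p = inj₂ (_ , ≃-sym p , t-con w lsig-Type)
  Large-sort w kind p = inj₁ (≃-sym p)

  -- A product has the sort of its codomain in λΠ, so applying a function whose type lives in `Kind`
  -- yields a type in `Kind` again.
  Large-app : ∀ {Δ t u A B T} → Large Δ (pi A B) → Δ ⊩ t ∶ pi A B → Δ ⊩ u ∶ A → B [ u ] ≃ T → Large Δ T
  Large-app (inj₁ p) d e q = ⊥-elim (con≄pi (≃-sym p))
  Large-app (inj₂ (_ , p , f)) d e q with pi-valid d
  ... | _ , _ , _ , lrule i , a , b with ≃-con-injective (⊩-functional-≃ p (t-pi (lrule i) a b) f)
  ...   | refl = inj₂ (_ , ≃-sym q , ⊩-[] b e)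

  mutual
    -- The annotation and the inferred codomain of an abstraction need not be translations, so the
    -- type to rebuild from is imposed from outside.
    check : ∀ {Γ Δ t T T₀ A} → Nf t → Δ ≈Γ Γ → Pr.Wf Γ → Δ ⊩ t ∶ T → T ≃ T₀ →
            T₀ ≈ A → Δ ⊩ T₀ ∶ con Type → Pr.Valid Γ A → Checked Δ Γ t T₀ A
    check (nf-ne n) g w d p q dT v with synthesise n g w d
    ... | inj₂ l = ⊥-elim (Large⇒¬Type l p dT)
    ... | inj₁ (_ , _ , p' , q' , dT' , _ , _ , u , r , e , t) with ≃-sym p' ◅◅ p
    ...   | p″ = _ , _ , PSR.conv-valid u v (≈-reflects-≃ q' q p″) , r , e , conv type t dT p″
    check (nf-lam n) g w d p q dT v with inv-lam d
    ... | _ , _ , _ , _ , lrule _ , c , _ , t , r with ≈-≃-pi q dT v (≃-sym (r ◅◅ p))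
    ...   | _ , _ , _ , _ , _ , _ , _ , eA , dPi , pa , pb , a , b , eT
          with ≃-pi-injective (r ◅◅ p ◅◅ eT) | Pr.inv-pi dPi
    ...     | e₁ , e₂ | _ , _ , _ , R , dA , dB , _
            -- The body is moved to the context headed by the expected domain, which is convertible
            -- to the original annotation.
            with check n (≈El pa ∷ g) (Pr.wf-∷ tt dA) (⊩-ctx-conv type (≃-sym e₁) (⊩eps a) t)
                       e₂ (≈El pb) (⊩eps b) (inj₂ (_ , tt , dB))
    ...       | _ , _ , u , s , e , t' =
      _ , _ , PSR.conv-valid (Pr.t-lam R dA dB u) v (Pr.≃-sym eA) , ~lam pa s , ≃-lam e₁ e ,
      conv type (t-lam (lrule type) (⊩eps a) (⊩eps b) t') dT (≃-sym eT)

    -- A neutral term gets its type from its head: a context entry or a sort's code leads to a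
    -- translated type, whereas `U`, `eps`, `Type` and products lead to large types. `check`
    -- discards the latter because its expected type lives in `Type`.
    synthesise : ∀ {Γ Δ t T} → Ne t → Δ ≈Γ Γ → Pr.Wf Γ → Δ ⊩ t ∶ T → Synthesised Δ Γ t T ⊎ Large Δ T
    synthesise ne-var g w d with inv-var d
    ... | _ , x , p with ≈Γ-lookupˡ g x | ∋-valid (⊩⇒Wf d) x
    ...   | _ , y , q | _ , _ , e =
      inj₁ (_ , _ , ≃-sym p , q , ≈⇒Type q e , _ , _ , Pr.t-var w y , ~var , ε , t-var (⊩⇒Wf d) x)
    synthesise (ne-con plain) g w d with inv-con d
    ... | _ , lsig-Type , p = inj₂ (Large-sort (⊩⇒Wf d) kind p)
    ... | _ , lsig (sig-U _) , p = inj₂ (Large-sort (⊩⇒Wf d) type p)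
    ... | _ , lsig (sig-eps _) , p =
      inj₂ (inj₂ (_ , ≃-sym p , t-pi (lrule kind) dU (t-con (wf-∷ type dU) lsig-Type)))
      where dU = ⊩U (⊩⇒Wf d)
    ... | _ , lsig (sig-dot a) , p =
      inj₁ (_ , _ , ≃-sym p , ≈U , ⊩U (⊩⇒Wf d) , _ , _ , Pr.t-con w (psig a) , ~sort , ε ,
            t-con (⊩⇒Wf d) (lsig (sig-dot a)))
    -- A bare Π̇ is ruled out by longness; only its full application is neutral.
    synthesise (ne-con ()) g w d | _ , lsig (sig-dotPi _) , _
    synthesise ne-pi g w d with inv-pi d
    ... | _ , _ , _ , lrule i , _ , _ , p = inj₂ (Large-sort (⊩⇒Wf d) i p)
    synthesise (ne-app n m) g w d with inv-app d
    ... | _ , _ , e , f , p with synthesise n g w e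
    ...   | inj₂ l = inj₂ (Large-app l e f p)
    ...   | inj₁ (_ , _ , p' , q , dT , _ , _ , u , r , eq , t) with ≈-≃-pi q dT (Pr.⊩-valid u) (≃-sym p')
    ...     | _ , _ , _ , _ , _ , _ , _ , eA , dPi , pa , pb , a , b , eT
            with ≃-pi-injective (p' ◅◅ eT) | Pr.inv-pi dPi
    ...       | e₁ , e₂ | _ , _ , _ , R , dA , dB , _
              with check m g w f e₁ (≈El pa) (⊩eps a) (inj₂ (_ , tt , dA))
    -- The result type contains the rebuilt argument in place of the original one, hence the appeal
    -- to `eq'`.
    ...         | _ , _ , v , r' , eq' , t' =
      inj₁ (_ , _ , ≃-sym p ◅◅ ≃-[] e₂ eq' , ≈El (~-[] pb r') , ⊩-[] (⊩eps b) t' , _ , _ ,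
            Pr.t-app (Pr.conv tt u dPi eA) v , ~app r r' , ≃-app eq eq' ,
            t-app (conv type t (pi-El-Type a b) eT) t')
    synthesise (ne-dotPi n m) g w d with inv-dotPi-lam d
    -- `U s₁` translates the sort `s₁` whether or not that sort is typable, so validity takes its
    -- first alternative.
    ... | R , a , p , b , q with check n g w a ε ≈U (⊩U (⊩⇒Wf d)) (inj₁ (_ , tt , refl))
    ...   | _ , _ , A , r , eq , a' with p ◅◅ ≃-app ε eq
    ...     | p' with check m (≈El r ∷ g) (Pr.wf-∷ tt A) (⊩-ctx-conv type (≃-sym p') (⊩eps a') b)
                           ε ≈U (⊩U (wf-∷ type (⊩eps a'))) (inj₁ (_ , tt , refl))
    ...       | _ , _ , B , r' , eq' , b' =
      inj₁ (_ , _ , ≃-sym q , ≈U , ⊩U (⊩⇒Wf d) , _ , _ , Pr.t-pi R A B , ~pi r r' ,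
            ≃-app (≃-app ε eq) (≃-lam p' eq') , ⊩Prod R a' b')

  TrTy-typed : ∀ {A T} → TrTy [] A T → T ≈ A × [] ⊩ T ∶ con Type × Pr.Valid [] A
  TrTy-typed (trty-typed d p) = ≈El (Tr⇒~ p) , ⊩eps (Tr-code p d [] wf-[]) , inj₂ (_ , tt , P-in d)
  TrTy-typed (trty-sort _)    = ≈U , ⊩U wf-[] , inj₁ (_ , tt , refl)

  embedding-sound : ∀ {A T} → TrTy [] A T → (∃ λ u → [] ⊢ u ∶ A) → ∃ λ t → [] ⊢λ t ∶ T
  embedding-sound tr (_ , d) with TrTy-typed tr | sound (P-in d) [] wf-[]
  ... | p , dT , _ | _ , _ , _ , q , dT' , t = _ , L-out (conv type t dT (≈-coherent q p ε dT' dT))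

  embedding-conservative : Terminating → ∀ {A T} → TrTy [] A T →
                           (∃ λ t → [] ⊢λ t ∶ T) → ∃ λ u → [] ⊢ u ∶ A
  embedding-conservative terminating tr (t , d) with ⊩η (L-in d)
  -- Termination is invoked on the expanded term, which has type `η T`; `≈-η` then leads back to
  -- `T`.
  ... | e with normalise e (Long-η t) (terminating _ _ _ (L-out e)) | TrTy-typed tr
  ...   | _ , n , f | p , dT , v with check n [] Pr.wf-[] f (≈-η p) p dT v
  ...     | _ , _ , u , _ = _ , P-out u

theorem1 : (P : PTS) → Functional P → Typing.Terminating P →
    let open Typing P in
    ∀ (A : PTerm) (T : LTerm) → TrTy [] A T →
    ((∃ λ t → [] ⊢λ t ∶ T) → (∃ λ u → [] ⊢ u ∶ A))
    × ((∃ λ u → [] ⊢ u ∶ A) → (∃ λ t → [] ⊢λ t ∶ T))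
theorem1 P functional terminating A T tr =
  embedding-conservative P functional terminating tr , embedding-sound P functional tr
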